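{- In each item below, the real and complex minimum positive semidefinite ranks of the indicated graph coincide, and their common value $\mathrm{mr}_+$ is as stated. In items (1), (2), (3), (5), (6), $T$ and $T'$ are trees of order $m\ge2$ and $m'\ge2$, respectively; $K_r$ denotes the complete graph on $r\ge 2$ vertices and $C_r$ the cycle on $r\ge3$ vertices. (1) $\mathrm{mr}_+(T\circ T')=mm'-1$. (2) $\mathrm{mr}_+(T\circ K_n)=2m-1$ for $n\ge2$. (3) $\mathrm{mr}_+(K_n\circ T)=nm-n+1$. (4) $\mathrm{mr}_+(K_n\circ K_m)=n+1$. (5) $\mathrm{mr}_+(C_n\circ T)=nm-2$. (6) $\mathrm{mr}_+(T\circ C_n)=m(n-1)-1$. (7) $\mathrm{mr}_+(C_n\circ K_m)=2n-2$. (8) $\mathrm{mr}_+(K_m\circ C_n)=m(n-2)+1$. (9) $\mathrm{mr}_+(C_n\circ C_m)=n(m-1)-2$.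
   Context: All graphs are finite and simple. For an $N\times N$ Hermitian matrix $A$, $\mathcal{G}(A)$ is the simple graph on $\{1,\dots,N\}$ in which distinct $i,j$ are adjacent iff $A_{ij}\ne0$ (the diagonal is unconstrained). For a graph $G$ on $N$ vertices, $\mathrm{mr}_+^{\mathbb{R}}(G)$ (resp. $\mathrm{mr}_+^{\mathbb{C}}(G)$) is the minimum rank of a real symmetric (resp. complex Hermitian) positive semidefinite $N\times N$ matrix $B$ with $\mathcal{G}(B)=G$. If the two numbers are equal, the common value is denoted $\mathrm{mr}_+(G)$. The corona product $G_1\circ G_2$ of $G_1=(V_1,E_1)$ with $G_2=(V_2,E_2)$ is the graph of order $|V_1||V_2|+|V_1|$ obtained by taking one copy of $G_1$ and $|V_1|$ copies of $G_2$, and joining every vertex of the $i$th copy of $G_2$ to the $i$th vertex of $G_1$. -}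

module Defs where

open import Algebra.Bundles using (RawRing)
import Algebra.Definitions.RawMonoid as RawMonoidDefinitions
open import Data.Fin.Base using (Fin; toℕ; splitAt; remQuot)
import Data.Fin.Properties as Fin
open import Data.Nat.Base as ℕ using (ℕ; suc; _⊔_)
import Data.Nat.Properties as ℕ
open import Data.Product.Base using (Σ-syntax; ∃-syntax; _×_; _,_; proj₁; proj₂)
open import Data.Rational.Base as ℚ using (ℚ; 0ℚ; 1ℚ; ½)
import Data.Rational.Properties as ℚ
open import Data.Rational.Solver using (module +-*-Solver)
open import Data.Sum.Base as Sum using (_⊎_; inj₁; inj₂)
open import Data.Vec.Functional using (Vector)
open import Function.Base using (id; _∘_; _on_)
open import Function.Bundles using (_⇔_)
open import Function.Definitions using (Injective)
open import Level using (0ℓ)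
open import Relation.Binary.Core using (Rel)
open import Relation.Binary.Construct.Closure.ReflexiveTransitive using (Star)
open import Relation.Binary.Definitions using (Decidable; Irreflexive; Symmetric)
open import Relation.Binary.PropositionalEquality
  using (_≡_; _≢_; refl; sym; trans; cong; cong₂; subst)
open import Relation.Nullary.Decidable using (_×-dec_; _⊎-dec_; ¬?)
open import Relation.Nullary.Negation using (¬_)

------------------------------------------------------------------------
-- Real numbers: Cauchy sequences of rationals, where two sequences are
-- identified (by the setoid equality _≈_) when their difference tends
-- to 0.  All the operations are pointwise; their proofs of convergence
-- are abstract, since nothing depends on the particular moduli.

IsCauchy : (ℕ → ℚ) → Set
IsCauchy x = ∀ ε → 0ℚ ℚ.< ε →
  ∃[ N ] (∀ m n → N ℕ.≤ m → N ℕ.≤ n → ℚ.∣ x m ℚ.- x n ∣ ℚ.< ε)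

private
  half-pos : ∀ {ε} → 0ℚ ℚ.< ε → 0ℚ ℚ.< ½ ℚ.* ε
  half-pos {ε} 0<ε =
    subst (ℚ._< ½ ℚ.* ε) (ℚ.*-zeroʳ ½) (ℚ.*-monoʳ-<-pos ½ 0<ε)

  halves : ∀ ε → ½ ℚ.* ε ℚ.+ ½ ℚ.* ε ≡ ε
  halves ε = trans (sym (ℚ.*-distribʳ-+ ε ½ ½)) (ℚ.*-identityˡ ε)

  bounded : ∀ x → IsCauchy x →
    ∃[ K ] ∃[ N ] (0ℚ ℚ.< K × (∀ n → N ℕ.≤ n → ℚ.∣ x n ∣ ℚ.≤ K))
  bounded x cx with cx 1ℚ (ℚ.positive⁻¹ 1ℚ)
  ... | N , near = 1ℚ ℚ.+ ℚ.∣ x N ∣ , N ,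
      ℚ.+-mono-<-≤ (ℚ.positive⁻¹ 1ℚ) (ℚ.0≤∣p∣ (x N)) , bound
    where
    open ℚ.≤-Reasoning
    open +-*-Solver
    bound : ∀ n → N ℕ.≤ n → ℚ.∣ x n ∣ ℚ.≤ 1ℚ ℚ.+ ℚ.∣ x N ∣
    bound n N≤n = begin
      ℚ.∣ x n ∣
        ≡⟨ cong ℚ.∣_∣ (solve 2 (λ a b → a := (a :- b) :+ b) refl (x n) (x N)) ⟩
      ℚ.∣ (x n ℚ.- x N) ℚ.+ x N ∣
        ≤⟨ ℚ.∣p+q∣≤∣p∣+∣q∣ (x n ℚ.- x N) (x N) ⟩
      ℚ.∣ x n ℚ.- x N ∣ ℚ.+ ℚ.∣ x N ∣
        ≤⟨ ℚ.+-monoˡ-≤ ℚ.∣ x N ∣ (ℚ.<⇒≤ (near n N N≤n ℕ.≤-refl)) ⟩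
      1ℚ ℚ.+ ℚ.∣ x N ∣ ∎

abstract

  const-cauchy : ∀ q → IsCauchy (λ _ → q)
  const-cauchy q ε 0<ε =
    0 , λ _ _ _ _ → subst (λ d → ℚ.∣ d ∣ ℚ.< ε) (sym (ℚ.+-inverseʳ q)) 0<ε

  +-cauchy : ∀ x y → IsCauchy x → IsCauchy y → IsCauchy (λ n → x n ℚ.+ y n)
  +-cauchy x y cx cy ε 0<ε
    with cx (½ ℚ.* ε) (half-pos 0<ε) | cy (½ ℚ.* ε) (half-pos 0<ε)
  ... | M , near-x | N , near-y = M ⊔ N , near
    where
    open ℚ.≤-Reasoning
    open +-*-Solver
    near : ∀ m n → M ⊔ N ℕ.≤ m → M ⊔ N ℕ.≤ n →
           ℚ.∣ (x m ℚ.+ y m) ℚ.- (x n ℚ.+ y n) ∣ ℚ.< ε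
    near m n p q = begin-strict
      ℚ.∣ (x m ℚ.+ y m) ℚ.- (x n ℚ.+ y n) ∣
        ≡⟨ cong ℚ.∣_∣ (solve 4 (λ a b c d → (a :+ b) :- (c :+ d) := (a :- c) :+ (b :- d))
             refl (x m) (y m) (x n) (y n)) ⟩
      ℚ.∣ (x m ℚ.- x n) ℚ.+ (y m ℚ.- y n) ∣
        ≤⟨ ℚ.∣p+q∣≤∣p∣+∣q∣ (x m ℚ.- x n) (y m ℚ.- y n) ⟩
      ℚ.∣ x m ℚ.- x n ∣ ℚ.+ ℚ.∣ y m ℚ.- y n ∣
        <⟨ ℚ.+-mono-< (near-x m n (ℕ.m⊔n≤o⇒m≤o M N p) (ℕ.m⊔n≤o⇒m≤o M N q))
                      (near-y m n (ℕ.m⊔n≤o⇒n≤o M N p) (ℕ.m⊔n≤o⇒n≤o M N q)) ⟩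
      ½ ℚ.* ε ℚ.+ ½ ℚ.* ε
        ≡⟨ halves ε ⟩
      ε ∎

  neg-cauchy : ∀ x → IsCauchy x → IsCauchy (λ n → ℚ.- x n)
  neg-cauchy x cx ε 0<ε with cx ε 0<ε
  ... | N , near = N , λ m n p q → subst (ℚ._< ε)
      (trans (sym (ℚ.∣-p∣≡∣p∣ (x m ℚ.- x n)))
             (cong ℚ.∣_∣ (ℚ.neg-distrib-+ (x m) (ℚ.- x n))))
      (near m n p q)

private
  module Products (x y : ℕ → ℚ) (cx : IsCauchy x) (cy : IsCauchy y) {ε} (0<ε : 0ℚ ℚ.< ε)
    {K L M₁ N₁} (0<K : 0ℚ ℚ.< K) (0<L : 0ℚ ℚ.< L)
    (∣x∣≤K : ∀ n → M₁ ℕ.≤ n → ℚ.∣ x n ∣ ℚ.≤ K)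
    (∣y∣≤L : ∀ n → N₁ ℕ.≤ n → ℚ.∣ y n ∣ ℚ.≤ L)
    where
    open ℚ.≤-Reasoning
    open +-*-Solver
    0<K+L : 0ℚ ℚ.< K ℚ.+ L
    0<K+L = ℚ.+-mono-< 0<K 0<L
    instance
      K-pos : ℚ.Positive K
      K-pos = ℚ.positive 0<K
      L-pos : ℚ.Positive L
      L-pos = ℚ.positive 0<L
      K+L-pos : ℚ.Positive (K ℚ.+ L)
      K+L-pos = ℚ.positive 0<K+L
      K+L-nonZero : ℚ.NonZero (K ℚ.+ L)
      K+L-nonZero = ℚ.pos⇒nonZero (K ℚ.+ L)
    δ : ℚ
    δ = ε ℚ.* ℚ.1/ (K ℚ.+ L)
    0<δ : 0ℚ ℚ.< δ
    0<δ = ℚ.positive⁻¹ δ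
      {{ℚ.pos*pos⇒pos ε {{ℚ.positive 0<ε}} (ℚ.1/ (K ℚ.+ L)) {{ℚ.1/pos⇒pos (K ℚ.+ L)}}}}
    split : K ℚ.* δ ℚ.+ δ ℚ.* L ≡ ε
    split = begin-equality
      K ℚ.* δ ℚ.+ δ ℚ.* L
        ≡⟨ solve 4 (λ k l e i → k :* (e :* i) :+ (e :* i) :* l := e :* (i :* (k :+ l)))
             refl K L ε (ℚ.1/ (K ℚ.+ L)) ⟩
      ε ℚ.* (ℚ.1/ (K ℚ.+ L) ℚ.* (K ℚ.+ L))
        ≡⟨ cong (ε ℚ.*_) (ℚ.*-inverseˡ (K ℚ.+ L)) ⟩
      ε ℚ.* 1ℚ
        ≡⟨ ℚ.*-identityʳ ε ⟩
      ε ∎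

    M₂ N₂ : ℕ
    M₂ = proj₁ (cx δ 0<δ)
    N₂ = proj₁ (cy δ 0<δ)

    near : ∀ m n → (M₁ ⊔ M₂) ⊔ (N₁ ⊔ N₂) ℕ.≤ m → (M₁ ⊔ M₂) ⊔ (N₁ ⊔ N₂) ℕ.≤ n →
           ℚ.∣ x m ℚ.* y m ℚ.- x n ℚ.* y n ∣ ℚ.< ε
    near m n p q = begin-strict
      ℚ.∣ x m ℚ.* y m ℚ.- x n ℚ.* y n ∣
        ≡⟨ cong ℚ.∣_∣ (solve 4
             (λ a b c d → a :* b :- c :* d := a :* (b :- d) :+ (a :- c) :* d)
             refl (x m) (y m) (x n) (y n)) ⟩
      ℚ.∣ x m ℚ.* (y m ℚ.- y n) ℚ.+ (x m ℚ.- x n) ℚ.* y n ∣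
        ≤⟨ ℚ.∣p+q∣≤∣p∣+∣q∣ (x m ℚ.* (y m ℚ.- y n)) ((x m ℚ.- x n) ℚ.* y n) ⟩
      ℚ.∣ x m ℚ.* (y m ℚ.- y n) ∣ ℚ.+ ℚ.∣ (x m ℚ.- x n) ℚ.* y n ∣
        ≡⟨ cong₂ ℚ._+_ (ℚ.∣p*q∣≡∣p∣*∣q∣ (x m) (y m ℚ.- y n))
                       (ℚ.∣p*q∣≡∣p∣*∣q∣ (x m ℚ.- x n) (y n)) ⟩
      ℚ.∣ x m ∣ ℚ.* ℚ.∣ y m ℚ.- y n ∣ ℚ.+ ℚ.∣ x m ℚ.- x n ∣ ℚ.* ℚ.∣ y n ∣
        ≤⟨ ℚ.+-mono-≤
             (ℚ.*-monoʳ-≤-nonNeg ℚ.∣ y m ℚ.- y n ∣ {{ℚ.∣-∣-nonNeg (y m ℚ.- y n)}}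
               (∣x∣≤K m (ℕ.m⊔n≤o⇒m≤o M₁ M₂ (ℕ.m⊔n≤o⇒m≤o (M₁ ⊔ M₂) (N₁ ⊔ N₂) p))))
             (ℚ.*-monoˡ-≤-nonNeg ℚ.∣ x m ℚ.- x n ∣ {{ℚ.∣-∣-nonNeg (x m ℚ.- x n)}}
               (∣y∣≤L n (ℕ.m⊔n≤o⇒m≤o N₁ N₂ (ℕ.m⊔n≤o⇒n≤o (M₁ ⊔ M₂) (N₁ ⊔ N₂) q)))) ⟩
      K ℚ.* ℚ.∣ y m ℚ.- y n ∣ ℚ.+ ℚ.∣ x m ℚ.- x n ∣ ℚ.* L
        <⟨ ℚ.+-mono-<
             (ℚ.*-monoʳ-<-pos K
               (proj₂ (cy δ 0<δ) m n (ℕ.m⊔n≤o⇒n≤o N₁ N₂ (ℕ.m⊔n≤o⇒n≤o (M₁ ⊔ M₂) (N₁ ⊔ N₂) p))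
                           (ℕ.m⊔n≤o⇒n≤o N₁ N₂ (ℕ.m⊔n≤o⇒n≤o (M₁ ⊔ M₂) (N₁ ⊔ N₂) q))))
             (ℚ.*-monoˡ-<-pos L
               (proj₂ (cx δ 0<δ) m n (ℕ.m⊔n≤o⇒n≤o M₁ M₂ (ℕ.m⊔n≤o⇒m≤o (M₁ ⊔ M₂) (N₁ ⊔ N₂) p))
                           (ℕ.m⊔n≤o⇒n≤o M₁ M₂ (ℕ.m⊔n≤o⇒m≤o (M₁ ⊔ M₂) (N₁ ⊔ N₂) q)))) ⟩
      K ℚ.* δ ℚ.+ δ ℚ.* L
        ≡⟨ split ⟩
      ε ∎

abstract

  *-cauchy : ∀ x y → IsCauchy x → IsCauchy y → IsCauchy (λ n → x n ℚ.* y n)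
  *-cauchy x y cx cy ε 0<ε =
    let K , M₁ , 0<K , ∣x∣≤K = bounded x cx
        L , N₁ , 0<L , ∣y∣≤L = bounded y cy
        open Products x y cx cy 0<ε {K} {L} {M₁} {N₁} 0<K 0<L ∣x∣≤K ∣y∣≤L
    in (M₁ ⊔ M₂) ⊔ (N₁ ⊔ N₂) , near

record ℝ : Set where
  constructor mkℝ
  field
    seq    : ℕ → ℚ
    cauchy : IsCauchy seq

open ℝ public

module Real where

  infix  4 _≈_ _≤_
  infix  8 -_
  infixl 7 _*_
  infixl 6 _+_

  _≈_ : Rel ℝ 0ℓ
  x ≈ y = ∀ ε → 0ℚ ℚ.< ε →
    ∃[ N ] (∀ n → N ℕ.≤ n → ℚ.∣ seq x n ℚ.- seq y n ∣ ℚ.< ε)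

  _≤_ : Rel ℝ 0ℓ
  x ≤ y = ∀ ε → 0ℚ ℚ.< ε →
    ∃[ N ] (∀ n → N ℕ.≤ n → seq x n ℚ.< seq y n ℚ.+ ε)

  fromℚ : ℚ → ℝ
  fromℚ q = mkℝ (λ _ → q) (const-cauchy q)

  0ℝ 1ℝ : ℝ
  0ℝ = fromℚ 0ℚ
  1ℝ = fromℚ 1ℚ

  _+_ _*_ : ℝ → ℝ → ℝ
  x + y = mkℝ (λ n → seq x n ℚ.+ seq y n) (+-cauchy (seq x) (seq y) (cauchy x) (cauchy y))
  x * y = mkℝ (λ n → seq x n ℚ.* seq y n) (*-cauchy (seq x) (seq y) (cauchy x) (cauchy y))

  -_ : ℝ → ℝ
  - x = mkℝ (λ n → ℚ.- seq x n) (neg-cauchy (seq x) (cauchy x))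

record ℂ : Set where
  constructor _+i_
  field
    re im : ℝ

open ℂ public

module Complex where

  infix  4 _≈_
  infix  8 -_
  infixl 7 _*_
  infixl 6 _+_

  _≈_ : Rel ℂ 0ℓ
  z ≈ w = re z Real.≈ re w × im z Real.≈ im w

  0ℂ 1ℂ : ℂ
  0ℂ = Real.0ℝ +i Real.0ℝ
  1ℂ = Real.1ℝ +i Real.0ℝ

  _+_ _*_ : ℂ → ℂ → ℂ
  z + w = (re z Real.+ re w) +i (im z Real.+ im w)
  z * w = (re z Real.* re w Real.+ Real.- (im z Real.* im w))
       +i (re z Real.* im w Real.+ im z Real.* re w)

  -_ conj : ℂ → ℂ
  - z    = (Real.- re z) +i (Real.- im z)
  conj z = re z +i (Real.- im z)

------------------------------------------------------------------------
-- Only the operations are bundled, and only at ℝ and ℂ are they used: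
-- conj is the identity on ℝ, so that the real symmetric and the complex
-- Hermitian case share their definitions.

record Scalars : Set₁ where
  field
    rawRing     : RawRing 0ℓ 0ℓ
  open RawRing rawRing public
  field
    conj        : Carrier → Carrier
    NonNegative : Carrier → Set

ℝ-scalars : Scalars
ℝ-scalars = record
  { rawRing     = record
    { Carrier = ℝ ; _≈_ = Real._≈_ ; _+_ = Real._+_ ; _*_ = Real._*_
    ; -_ = Real.-_ ; 0# = Real.0ℝ ; 1# = Real.1ℝ }
  ; conj        = id
  ; NonNegative = λ x → Real.0ℝ Real.≤ x
  }

ℂ-scalars : Scalars
ℂ-scalars = record
  { rawRing     = record
    { Carrier = ℂ ; _≈_ = Complex._≈_ ; _+_ = Complex._+_ ; _*_ = Complex._*_
    ; -_ = Complex.-_ ; 0# = Complex.0ℂ ; 1# = Complex.1ℂ }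
  ; conj        = Complex.conj
  ; NonNegative = λ z → (Real.0ℝ Real.≤ re z) × (im z Real.≈ Real.0ℝ)
  }

------------------------------------------------------------------------
-- Decidability of adjacency is no restriction classically; without it
-- no matrix with a prescribed graph can be constructed.

record Graph (n : ℕ) : Set₁ where
  field
    Adj        : Rel (Fin n) 0ℓ
    adj?       : Decidable Adj
    adj-irrefl : Irreflexive _≡_ Adj
    adj-sym    : Symmetric Adj

open Graph public

complete : ∀ n → Graph n
complete n = record
  { Adj        = _≢_
  ; adj?       = λ i j → ¬? (i Fin.≟ j)
  ; adj-irrefl = λ i≡j i≢j → i≢j i≡j
  ; adj-sym    = λ i≢j j≡i → i≢j (sym j≡i)
  }

CyclicSuc : ∀ {r} → Rel (Fin r) 0ℓ
CyclicSuc {r} i j = toℕ j ≡ suc (toℕ i) ⊎ (suc (toℕ i) ≡ r × toℕ j ≡ 0)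

private
  cyclicSuc? : ∀ {r} → Decidable (CyclicSuc {r})
  cyclicSuc? {r} i j =
    (toℕ j ℕ.≟ suc (toℕ i)) ⊎-dec ((suc (toℕ i) ℕ.≟ r) ×-dec (toℕ j ℕ.≟ 0))

-- The cycle Cᵣ when r ≥ 3; the conjunct i ≢ j only matters for r = 1.
cycle : ∀ r → Graph r
cycle r = record
  { Adj        = λ i j → i ≢ j × (CyclicSuc i j ⊎ CyclicSuc j i)
  ; adj?       = λ i j → ¬? (i Fin.≟ j) ×-dec (cyclicSuc? i j ⊎-dec cyclicSuc? j i)
  ; adj-irrefl = λ i≡j a → proj₁ a i≡j
  ; adj-sym    = λ (i≢j , s) → (λ j≡i → i≢j (sym j≡i)) , Sum.swap s
  }

Connected : ∀ {n} → Graph n → Set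
Connected G = ∀ i j → Star (Adj G) i j

Acyclic : ∀ {n} → Graph n → Set
Acyclic {n} G = ∀ r → 3 ℕ.≤ r → (c : Fin r → Fin n) → Injective _≡_ _≡_ c →
  ¬ (∀ i j → CyclicSuc i j → Adj G (c i) (c j))

IsTree : ∀ {n} → Graph n → Set
IsTree G = Connected G × Acyclic G

-- A vertex of the corona of graphs on Fin n and Fin m is either
-- inj₁ (i , u), the vertex u of the i-th copy of the second graph,
-- or inj₂ i, the vertex i of the first graph.
CoronaVertex : ℕ → ℕ → Set
CoronaVertex n m = (Fin n × Fin m) ⊎ Fin n

coronaVertex : ∀ n m → Fin (n ℕ.* m ℕ.+ n) → CoronaVertex n m
coronaVertex n m v = Sum.map₁ (remQuot {n} m) (splitAt (n ℕ.* m) v)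

module _ {n m} (G : Graph n) (H : Graph m) where

  CoronaAdj : Rel (CoronaVertex n m) 0ℓ
  CoronaAdj (inj₁ (i , u)) (inj₁ (j , v)) = i ≡ j × Adj H u v
  CoronaAdj (inj₁ (i , u)) (inj₂ j)       = i ≡ j
  CoronaAdj (inj₂ i)       (inj₁ (j , v)) = i ≡ j
  CoronaAdj (inj₂ i)       (inj₂ j)       = Adj G i j

  private
    coronaAdj? : Decidable CoronaAdj
    coronaAdj? (inj₁ (i , u)) (inj₁ (j , v)) = (i Fin.≟ j) ×-dec adj? H u v
    coronaAdj? (inj₁ (i , u)) (inj₂ j)       = i Fin.≟ j
    coronaAdj? (inj₂ i)       (inj₁ (j , v)) = i Fin.≟ j
    coronaAdj? (inj₂ i)       (inj₂ j)       = adj? G i j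

    coronaAdj-irrefl : ∀ x → ¬ CoronaAdj x x
    coronaAdj-irrefl (inj₁ (i , u)) (_ , a) = adj-irrefl H refl a
    coronaAdj-irrefl (inj₂ i)       a       = adj-irrefl G refl a

    coronaAdj-sym : Symmetric CoronaAdj
    coronaAdj-sym {inj₁ _} {inj₁ _} (e , a) = sym e , adj-sym H a
    coronaAdj-sym {inj₁ _} {inj₂ _} e       = sym e
    coronaAdj-sym {inj₂ _} {inj₁ _} e       = sym e
    coronaAdj-sym {inj₂ _} {inj₂ _} a       = adj-sym G a

  infixl 7 _∘ᶜ_

  _∘ᶜ_ : Graph (n ℕ.* m ℕ.+ n)
  _∘ᶜ_ = record
    { Adj        = CoronaAdj on coronaVertex n m
    ; adj?       = λ i j → coronaAdj? (coronaVertex n m i) (coronaVertex n m j)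
    ; adj-irrefl = λ { {i} refl a → coronaAdj-irrefl (coronaVertex n m i) a }
    ; adj-sym    = λ {i} {j} → coronaAdj-sym {coronaVertex n m i} {coronaVertex n m j}
    }

module PSD (𝕂 : Scalars) where

  open Scalars 𝕂
  open RawMonoidDefinitions +-rawMonoid using (sum)

  Matrix : ℕ → Set
  Matrix N = Fin N → Fin N → Carrier

  IsHermitian : ∀ {N} → Matrix N → Set
  IsHermitian A = ∀ i j → A i j ≈ conj (A j i)

  IsPSD : ∀ {N} → Matrix N → Set
  IsPSD {N} A = IsHermitian A ×
    ((x : Vector Carrier N) →
      NonNegative (sum λ i → sum λ j → conj (x i) * (A i j * x j)))

  𝒢 : ∀ {N} → Matrix N → Rel (Fin N) 0ℓ
  𝒢 A i j = i ≢ j × ¬ (A i j ≈ 0#)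

  HasGraph : ∀ {N} → Matrix N → Graph N → Set
  HasGraph A G = ∀ i j → 𝒢 A i j ⇔ Adj G i j

  LinearlyIndependent : ∀ {N s} → (Fin s → Vector Carrier N) → Set
  LinearlyIndependent {N} {s} v = (c : Vector Carrier s) →
    (∀ i → sum (λ k → c k * v k i) ≈ 0#) → ∀ k → c k ≈ 0#

  column : ∀ {N} → Matrix N → Fin N → Vector Carrier N
  column A j i = A i j

  -- The rank is the largest number of linearly independent columns.
  -- A selection f of columns that is linearly independent is injective.
  HasRank : ∀ {N} → Matrix N → ℕ → Set
  HasRank {N} A r =
    (Σ[ f ∈ (Fin r → Fin N) ] LinearlyIndependent (column A ∘ f)) ×
    (∀ s (f : Fin s → Fin N) → LinearlyIndependent (column A ∘ f) → s ℕ.≤ r)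

  IsMinPSDRank : ∀ {N} → Graph N → ℕ → Set
  IsMinPSDRank {N} G k =
    (Σ[ B ∈ Matrix N ] (IsPSD B × HasGraph B G × HasRank B k)) ×
    (∀ (B : Matrix N) r → IsPSD B → HasGraph B G → HasRank B r → k ℕ.≤ r)

IsMr₊ℝ IsMr₊ℂ : ∀ {N} → Graph N → ℕ → Set
IsMr₊ℝ = PSD.IsMinPSDRank ℝ-scalars
IsMr₊ℂ = PSD.IsMinPSDRank ℂ-scalars

-- mr₊(G) is defined and equal to k
IsMr₊ : ∀ {N} → Graph N → ℕ → Set
IsMr₊ G k = IsMr₊ℝ G k × IsMr₊ℂ G k

{-# OPTIONS --safe #-}

module Submission where

-- For graphs G of order n and H, a certificate for G of size r consists of
--   (a) vectors in ℚʳ whose Gram matrix has graph G, together with a vector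
--       orthogonal to none of them, and
--   (b) r vertices whose complement is a positive semidefinite forcing set.
-- By (a) the Gram matrix has rank at most r; by (b) the r columns of any
-- positive semidefinite matrix with graph G at the chosen vertices are
-- independent.  Hence mr₊(G) = r over ℝ and over ℂ.  Certificates for G and H
-- of sizes r and s combine to parts (a) and (b) for G ∘ H of size r + n s:
-- the i-th copy of H is represented in its own orthogonal block ℚˢ, the i-th
-- vertex of G acquires as component in that block the vector orthogonal to
-- none, and forcing in G extends over the copies of H.  Trees of order m,
-- complete graphs and cycles of order n have certificates of sizes m - 1, 1
-- and n - 2.

open import Defs
open import Algebra.Bundles using (CommutativeRing)
import Algebra.Properties.Ring as RingProperties
import Algebra.Properties.Semiring.Sum as SemiringSum
import Algebra.Solver.Ring.NaturalCoefficients.Default as NaturalCoefficients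
open import Algebra.Structures using (IsCommutativeRing)
open import Data.Bool.Base using (if_then_else_)
open import Data.Empty using (⊥)
open import Data.Fin.Base as Fin
  using (Fin; zero; suc; toℕ; fromℕ; inject₁; splitAt; join; remQuot; combine; punchIn; _↑ˡ_; _↑ʳ_)
import Data.Fin.Properties as Fin
open import Data.Nat.Base as ℕ using (ℕ; zero; suc; s≤s; z≤n; _⊔_)
import Data.Nat.Properties as ℕ
open import Data.Nat.Tactic.RingSolver using (solve-∀)
open import Data.Product.Base using (Σ-syntax; ∃-syntax; _×_; _,_; proj₁; proj₂; uncurry)
open import Data.Rational.Base as ℚ using (ℚ; 0ℚ; 1ℚ; ½)
import Data.Rational.Properties as ℚ
open import Data.Rational.Solver using (module +-*-Solver)
open import Data.Sum.Base as Sum using (_⊎_; inj₁; inj₂)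
open import Data.Sum.Properties using (inj₁-injective; inj₂-injective)
open import Data.Unit.Base using (⊤; tt)
open import Data.Vec.Functional using (Vector; insertAt; _++_; _∷_)
open import Data.Vec.Functional.Properties using (insertAt-lookup; insertAt-punchIn; lookup-++ˡ; lookup-++ʳ)
open import Effect.Monad using (RawMonad)
open import Function.Base using (_∘_)
open import Function.Bundles using (Equivalence; mk⇔)
open import Function.Definitions using (Injective)
open import Level using (0ℓ)
open import Relation.Binary.Core using (Rel)
open import Relation.Binary.Definitions using (tri<; tri≈; tri>)
open import Relation.Binary.PropositionalEquality
  using (_≡_; _≢_; refl; sym; trans; cong; cong₂; subst; module ≡-Reasoning)
import Relation.Binary.Reasoning.Setoid as SetoidReasoning
open import Relation.Binary.Structures using (IsEquivalence)
open import Relation.Nullary.Decidable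
  using (Dec; does; yes; no; ¬?; _⊎-dec_; decidable-stable; ¬¬-excluded-middle)
open import Relation.Nullary.Negation using (¬_; contradiction; ¬¬-Monad)

-- Scalars

-- Equality with 0 in ℝ and ℂ cannot be decided constructively, and this shapes both bounds. For the
-- upper bound, a dependence among too many columns has to be found by a search for pivots; rational
-- vectors allow this search, and one rational Gram matrix then serves ℝ and ℂ alike.
--
-- The two sizes add up without loss in a corona because vertex i of G together with its copy of H
-- is a cone over H. On the Gram side the cone needs no dimension beyond the s of H, since a vector
-- orthogonal to none of the vectors of H can stand for the new vertex. On the forcing side the cone
-- vertex is forced before its copy, and then no longer obstructs the forcing inside that copy.

record IsInvolutiveDomain (𝕂 : Scalars) : Set where
  open Scalars 𝕂
  field
    isCommutativeRing : IsCommutativeRing _≈_ _+_ _*_ -_ 0# 1#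
    conj-cong         : ∀ {x y} → x ≈ y → conj x ≈ conj y
    conj-+            : ∀ x y → conj (x + y) ≈ conj x + conj y
    conj-*            : ∀ x y → conj (x * y) ≈ conj x * conj y
    conj-involutive   : ∀ x → conj (conj x) ≈ x
    ≈0-stable         : ∀ x → ¬ ¬ (x ≈ 0#) → x ≈ 0#
    noZeroDivisors    : ∀ x y → x * y ≈ 0# → ¬ (x ≈ 0#) → y ≈ 0#
    nonNeg-resp-≈     : ∀ {x y} → x ≈ y → NonNegative x → NonNegative y
    nonNeg-+          : ∀ {x y} → NonNegative x → NonNegative y → NonNegative (x + y)
    nonNeg-norm       : ∀ x → NonNegative (conj x * x)
    nonNeg-antisym    : ∀ {x} → NonNegative x → NonNegative (- x) → x ≈ 0#
    conj-nonNeg       : ∀ {x} → NonNegative x → conj x ≈ x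
    fromℚ             : ℚ → Carrier
    fromℚ-0           : fromℚ 0ℚ ≈ 0#
    fromℚ-+           : ∀ p q → fromℚ (p ℚ.+ q) ≈ fromℚ p + fromℚ q
    fromℚ-*           : ∀ p q → fromℚ (p ℚ.* q) ≈ fromℚ p * fromℚ q
    fromℚ-injective₀  : ∀ q → fromℚ q ≈ 0# → q ≡ 0ℚ
    conj-fromℚ        : ∀ q → conj (fromℚ q) ≈ fromℚ q

-- Null sequences of rationals; equality in ℝ is nullity of the difference

Null : (ℕ → ℚ) → Set
Null d = ∀ ε → 0ℚ ℚ.< ε → ∃[ N ] (∀ n → N ℕ.≤ n → ℚ.∣ d n ∣ ℚ.< ε)

½*-pos : ∀ {ε} → 0ℚ ℚ.< ε → 0ℚ ℚ.< ½ ℚ.* ε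
½*-pos {ε} 0<ε = subst (ℚ._< ½ ℚ.* ε) (ℚ.*-zeroʳ ½) (ℚ.*-monoʳ-<-pos ½ 0<ε)

½*+½* : ∀ ε → ½ ℚ.* ε ℚ.+ ½ ℚ.* ε ≡ ε
½*+½* ε = trans (sym (ℚ.*-distribʳ-+ ε ½ ½)) (ℚ.*-identityˡ ε)

null-0 : Null (λ _ → 0ℚ)
null-0 ε 0<ε = 0 , λ _ _ → 0<ε

null-resp-≗ : ∀ {d e} → (∀ n → d n ≡ e n) → Null d → Null e
null-resp-≗ d≗e nd ε 0<ε with nd ε 0<ε
... | N , small = N , λ n N≤n → subst (λ q → ℚ.∣ q ∣ ℚ.< ε) (d≗e n) (small n N≤n)

null-neg : ∀ {d} → Null d → Null (λ n → ℚ.- d n)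
null-neg {d} nd ε 0<ε with nd ε 0<ε
... | N , small = N , λ n N≤n → subst (ℚ._< ε) (sym (ℚ.∣-p∣≡∣p∣ (d n))) (small n N≤n)

null-+ : ∀ {d e} → Null d → Null e → Null (λ n → d n ℚ.+ e n)
null-+ {d} {e} nd ne ε 0<ε with nd (½ ℚ.* ε) (½*-pos 0<ε) | ne (½ ℚ.* ε) (½*-pos 0<ε)
... | M , small-d | N , small-e = M ⊔ N , λ n p → begin-strict
      ℚ.∣ d n ℚ.+ e n ∣           ≤⟨ ℚ.∣p+q∣≤∣p∣+∣q∣ (d n) (e n) ⟩
      ℚ.∣ d n ∣ ℚ.+ ℚ.∣ e n ∣
        <⟨ ℚ.+-mono-< (small-d n (ℕ.m⊔n≤o⇒m≤o M N p)) (small-e n (ℕ.m⊔n≤o⇒n≤o M N p)) ⟩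
      ½ ℚ.* ε ℚ.+ ½ ℚ.* ε         ≡⟨ ½*+½* ε ⟩
      ε                           ∎
  where open ℚ.≤-Reasoning

cauchy-bounded : ∀ x → IsCauchy x →
  ∃[ K ] ∃[ N ] (0ℚ ℚ.< K × (∀ n → N ℕ.≤ n → ℚ.∣ x n ∣ ℚ.≤ K))
cauchy-bounded x cx with cx 1ℚ (ℚ.positive⁻¹ 1ℚ)
... | N , near = 1ℚ ℚ.+ ℚ.∣ x N ∣ , N ,
    ℚ.+-mono-<-≤ (ℚ.positive⁻¹ 1ℚ) (ℚ.0≤∣p∣ (x N)) , λ n N≤n → begin
      ℚ.∣ x n ∣
        ≡⟨ cong ℚ.∣_∣ (solve 2 (λ a b → a := (a :- b) :+ b) refl (x n) (x N)) ⟩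
      ℚ.∣ (x n ℚ.- x N) ℚ.+ x N ∣
        ≤⟨ ℚ.∣p+q∣≤∣p∣+∣q∣ (x n ℚ.- x N) (x N) ⟩
      ℚ.∣ x n ℚ.- x N ∣ ℚ.+ ℚ.∣ x N ∣
        ≤⟨ ℚ.+-monoˡ-≤ ℚ.∣ x N ∣ (ℚ.<⇒≤ (near n N N≤n ℕ.≤-refl)) ⟩
      1ℚ ℚ.+ ℚ.∣ x N ∣ ∎
  where
  open ℚ.≤-Reasoning
  open +-*-Solver

divide-pos : ∀ {K ε} → 0ℚ ℚ.< K → 0ℚ ℚ.< ε → ∃[ δ ] (0ℚ ℚ.< δ × K ℚ.* δ ≡ ε)
divide-pos {K} {ε} 0<K 0<ε = ε ℚ.* ℚ.1/ K ,
  ℚ.positive⁻¹ _ {{ℚ.pos*pos⇒pos ε {{ℚ.positive 0<ε}} (ℚ.1/ K) {{ℚ.1/pos⇒pos K}}}} ,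
  trans (solve 3 (λ k e i → k :* (e :* i) := e :* (k :* i)) refl K ε (ℚ.1/ K))
        (trans (cong (ε ℚ.*_) (ℚ.*-inverseʳ K)) (ℚ.*-identityʳ ε))
  where
  open +-*-Solver
  instance
    K-pos : ℚ.Positive K
    K-pos = ℚ.positive 0<K
    K-nonZero : ℚ.NonZero K
    K-nonZero = ℚ.pos⇒nonZero K

null-bounded-* : ∀ {x d} → IsCauchy x → Null d → Null (λ n → x n ℚ.* d n)
null-bounded-* {x} {d} cx nd ε 0<ε =
  let K , M , 0<K , ∣x∣≤K = cauchy-bounded x cx
      δ , 0<δ , Kδ≡ε      = divide-pos 0<K 0<ε
      N , small           = nd δ 0<δ
  in M ⊔ N , λ n p → begin-strict
    ℚ.∣ x n ℚ.* d n ∣       ≡⟨ ℚ.∣p*q∣≡∣p∣*∣q∣ (x n) (d n) ⟩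
    ℚ.∣ x n ∣ ℚ.* ℚ.∣ d n ∣
      ≤⟨ ℚ.*-monoʳ-≤-nonNeg ℚ.∣ d n ∣ {{ℚ.∣-∣-nonNeg (d n)}} (∣x∣≤K n (ℕ.m⊔n≤o⇒m≤o M N p)) ⟩
    K ℚ.* ℚ.∣ d n ∣         <⟨ ℚ.*-monoʳ-<-pos K {{ℚ.positive 0<K}} (small n (ℕ.m⊔n≤o⇒n≤o M N p)) ⟩
    K ℚ.* δ                 ≡⟨ Kδ≡ε ⟩
    ε                       ∎
  where
  open ℚ.≤-Reasoning

-- The classical alternative "x tends to 0 or stays away from 0", at the
-- scale ε: it is decided by one sufficiently late term of the sequence.
small⊎apart : ∀ x → IsCauchy x → ∀ ε → 0ℚ ℚ.< ε →
  (∃[ N ] (∀ n → N ℕ.≤ n → ℚ.∣ x n ∣ ℚ.< ε)) ⊎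
  (∃[ δ ] ∃[ N ] (0ℚ ℚ.< δ × (∀ n → N ℕ.≤ n → δ ℚ.≤ ℚ.∣ x n ∣)))
small⊎apart x cx ε 0<ε with cx (½ ℚ.* (½ ℚ.* ε)) (½*-pos (½*-pos 0<ε))
-- Late terms differ from `x N` by less than ε/4. If `x N` is below ε/2 in absolute value they stay
-- below ε/4 + ε/2; otherwise they stay above ε/2 - ε/4, which is the δ returned.
... | N , near with ℚ.∣ x N ∣ ℚ.<? ½ ℚ.* ε
...   | yes small = inj₁ (N , λ n N≤n → begin-strict
      ℚ.∣ x n ∣
        ≡⟨ cong ℚ.∣_∣ (solve 2 (λ a b → a := (a :- b) :+ b) refl (x n) (x N)) ⟩
      ℚ.∣ (x n ℚ.- x N) ℚ.+ x N ∣             ≤⟨ ℚ.∣p+q∣≤∣p∣+∣q∣ (x n ℚ.- x N) (x N) ⟩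
      ℚ.∣ x n ℚ.- x N ∣ ℚ.+ ℚ.∣ x N ∣         <⟨ ℚ.+-mono-< (near n N N≤n ℕ.≤-refl) small ⟩
      ½ ℚ.* (½ ℚ.* ε) ℚ.+ ½ ℚ.* ε             ≤⟨ ℚ.+-monoˡ-≤ (½ ℚ.* ε) (quarter≤half) ⟩
      ½ ℚ.* ε ℚ.+ ½ ℚ.* ε                     ≡⟨ ½*+½* ε ⟩
      ε                                       ∎)
  where
  open ℚ.≤-Reasoning
  open +-*-Solver
  quarter≤half : ½ ℚ.* (½ ℚ.* ε) ℚ.≤ ½ ℚ.* ε
  quarter≤half = begin
    ½ ℚ.* (½ ℚ.* ε)                         ≡⟨ ℚ.+-identityʳ _ ⟨
    ½ ℚ.* (½ ℚ.* ε) ℚ.+ 0ℚ                  ≤⟨ ℚ.+-monoʳ-≤ (½ ℚ.* (½ ℚ.* ε)) (ℚ.<⇒≤ (½*-pos (½*-pos 0<ε))) ⟩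
    ½ ℚ.* (½ ℚ.* ε) ℚ.+ ½ ℚ.* (½ ℚ.* ε)     ≡⟨ ½*+½* (½ ℚ.* ε) ⟩
    ½ ℚ.* ε                                 ∎
...   | no large = inj₂ (½ ℚ.* (½ ℚ.* ε) , N , ½*-pos (½*-pos 0<ε) , λ n N≤n → +-cancelʳ-≤ (begin
      ½ ℚ.* (½ ℚ.* ε) ℚ.+ ½ ℚ.* (½ ℚ.* ε)     ≡⟨ ½*+½* (½ ℚ.* ε) ⟩
      ½ ℚ.* ε                                 ≤⟨ ℚ.≮⇒≥ large ⟩
      ℚ.∣ x N ∣
        ≡⟨ cong ℚ.∣_∣ (solve 2 (λ a b → a := b :+ (a :- b)) refl (x N) (x n)) ⟩
      ℚ.∣ x n ℚ.+ (x N ℚ.- x n) ∣             ≤⟨ ℚ.∣p+q∣≤∣p∣+∣q∣ (x n) (x N ℚ.- x n) ⟩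
      ℚ.∣ x n ∣ ℚ.+ ℚ.∣ x N ℚ.- x n ∣         ≤⟨ ℚ.+-monoʳ-≤ ℚ.∣ x n ∣ (ℚ.<⇒≤ (near N n ℕ.≤-refl N≤n)) ⟩
      ℚ.∣ x n ∣ ℚ.+ ½ ℚ.* (½ ℚ.* ε)           ∎))
  where
  open ℚ.≤-Reasoning
  open +-*-Solver
  +-cancelʳ-≤ : ∀ {p q r} → p ℚ.+ r ℚ.≤ q ℚ.+ r → p ℚ.≤ q
  +-cancelʳ-≤ {p} {q} {r} le = begin
    p                  ≡⟨ solve 2 (λ a c → a := (a :+ c) :- c) refl p r ⟩
    (p ℚ.+ r) ℚ.- r    ≤⟨ ℚ.+-monoˡ-≤ (ℚ.- r) le ⟩
    (q ℚ.+ r) ℚ.- r    ≡⟨ solve 2 (λ a c → (a :+ c) :- c := a) refl q r ⟩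
    q                  ∎

-- At each scale `small⊎apart` gives a genuine alternative, and a positive lower bound on all late
-- terms would refute `Null x`. No excluded middle is involved.
null-stable : ∀ {x} → IsCauchy x → ¬ ¬ Null x → Null x
null-stable {x} cx ¬¬null ε 0<ε with small⊎apart x cx ε 0<ε
... | inj₁ small = small
... | inj₂ (δ , N , 0<δ , apart) = contradiction not-null ¬¬null
  where
  not-null : ¬ Null x
  not-null null with null δ 0<δ
  ... | M , small = ℚ.<-irrefl refl
    (ℚ.≤-<-trans (apart (N ⊔ M) (ℕ.m≤m⊔n N M)) (small (N ⊔ M) (ℕ.m≤n⊔m N M)))

-- If late terms of y were at least δ in absolute value, a product below ηδ would force x below η
-- for every η, making x null.
null-*-cancel : ∀ {x y} → IsCauchy y → Null (λ n → x n ℚ.* y n) → ¬ Null x → Null y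
null-*-cancel {x} {y} cy nxy ¬nx ε 0<ε with small⊎apart y cy ε 0<ε
... | inj₁ small = small
... | inj₂ (δ , N , 0<δ , apart) = contradiction null-x ¬nx
  where
  open ℚ.≤-Reasoning
  instance
    δ-pos : ℚ.Positive δ
    δ-pos = ℚ.positive 0<δ
  null-x : Null x
  null-x η 0<η with nxy (η ℚ.* δ) (ℚ.positive⁻¹ _ {{ℚ.pos*pos⇒pos η {{ℚ.positive 0<η}} δ}})
  ... | M , small = N ⊔ M , λ n p → ℚ.*-cancelʳ-<-nonNeg δ {{ℚ.pos⇒nonNeg δ}} (begin-strict
    ℚ.∣ x n ∣ ℚ.* δ
      ≤⟨ ℚ.*-monoˡ-≤-nonNeg ℚ.∣ x n ∣ {{ℚ.∣-∣-nonNeg (x n)}} (apart n (ℕ.m⊔n≤o⇒m≤o N M p)) ⟩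
    ℚ.∣ x n ∣ ℚ.* ℚ.∣ y n ∣   ≡⟨ ℚ.∣p*q∣≡∣p∣*∣q∣ (x n) (y n) ⟨
    ℚ.∣ x n ℚ.* y n ∣         <⟨ small n (ℕ.m⊔n≤o⇒n≤o N M p) ⟩
    η ℚ.* δ                   ∎)

-- The real numbers as an involutive domain

module ℝ-Properties where
  open Real
  open +-*-Solver

  pointwise : ∀ {x y} → (∀ n → seq x n ≡ seq y n) → x ≈ y
  pointwise {x} {y} eq = null-resp-≗ {λ _ → 0ℚ}
    (λ n → sym (trans (cong (ℚ._- seq y n) (eq n)) (ℚ.+-inverseʳ (seq y n)))) null-0

  ≈0⇒null : ∀ {x} → x ≈ 0ℝ → Null (seq x)
  ≈0⇒null {x} = null-resp-≗ (λ n → ℚ.+-identityʳ (seq x n))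

  null⇒≈0 : ∀ {x} → Null (seq x) → x ≈ 0ℝ
  null⇒≈0 {x} = null-resp-≗ (λ n → sym (ℚ.+-identityʳ (seq x n)))

  ≈-isEquivalence : IsEquivalence _≈_
  ≈-isEquivalence = record
    { refl  = λ {x} → pointwise {x} {x} λ _ → refl
    ; sym   = λ {x} {y} x≈y → null-resp-≗
        (λ n → solve 2 (λ a b → :- (a :- b) := b :- a) refl (seq x n) (seq y n)) (null-neg x≈y)
    ; trans = λ {x} {y} {z} x≈y y≈z → null-resp-≗
        (λ n → solve 3 (λ a b c → (a :- b) :+ (b :- c) := a :- c) refl (seq x n) (seq y n) (seq z n))
        (null-+ x≈y y≈z)
    }

  +-cong : ∀ {x y u v} → x ≈ y → u ≈ v → x + u ≈ y + v
  +-cong {x} {y} {u} {v} x≈y u≈v = null-resp-≗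
    (λ n → solve 4 (λ a b c d → (a :- b) :+ (c :- d) := (a :+ c) :- (b :+ d)) refl
      (seq x n) (seq y n) (seq u n) (seq v n))
    (null-+ x≈y u≈v)

  *-cong : ∀ {x y u v} → x ≈ y → u ≈ v → x * u ≈ y * v
  *-cong {x} {y} {u} {v} x≈y u≈v = null-resp-≗
    (λ n → solve 4 (λ a b c d → c :* (a :- b) :+ b :* (c :- d) := a :* c :- b :* d) refl
      (seq x n) (seq y n) (seq u n) (seq v n))
    (null-+ {λ n → seq u n ℚ.* (seq x n ℚ.- seq y n)} {λ n → seq y n ℚ.* (seq u n ℚ.- seq v n)}
      (null-bounded-* {seq u} (cauchy u) x≈y) (null-bounded-* {seq y} (cauchy y) u≈v))

  -‿cong : ∀ {x y} → x ≈ y → - x ≈ - y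
  -‿cong {x} {y} x≈y = null-resp-≗
    (λ n → solve 2 (λ a b → :- (a :- b) := (:- a) :- (:- b)) refl (seq x n) (seq y n)) (null-neg x≈y)

  isCommutativeRing : IsCommutativeRing _≈_ _+_ _*_ -_ 0ℝ 1ℝ
  isCommutativeRing = record
    { isRing = record
      { +-isAbelianGroup = record
        { isGroup = record
          { isMonoid = record
            { isSemigroup = record
              { isMagma = record { isEquivalence = ≈-isEquivalence ; ∙-cong = λ {x} {y} {u} {v} → +-cong {x} {y} {u} {v} }
              ; assoc = λ x y z → pointwise {x + y + z} {x + (y + z)} λ n → ℚ.+-assoc (seq x n) (seq y n) (seq z n)
              }
            ; identity = (λ x → pointwise {0ℝ + x} {x} λ n → ℚ.+-identityˡ (seq x n))
                       , (λ x → pointwise {x + 0ℝ} {x} λ n → ℚ.+-identityʳ (seq x n))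
            }
          ; inverse = (λ x → pointwise {(- x) + x} {0ℝ} λ n → ℚ.+-inverseˡ (seq x n))
                    , (λ x → pointwise {x + (- x)} {0ℝ} λ n → ℚ.+-inverseʳ (seq x n))
          ; ⁻¹-cong = λ {x} {y} → -‿cong {x} {y}
          }
        ; comm = λ x y → pointwise {x + y} {y + x} λ n → ℚ.+-comm (seq x n) (seq y n)
        }
      ; *-cong = λ {x} {y} {u} {v} → *-cong {x} {y} {u} {v}
      ; *-assoc = λ x y z → pointwise {x * y * z} {x * (y * z)} λ n → ℚ.*-assoc (seq x n) (seq y n) (seq z n)
      ; *-identity = (λ x → pointwise {1ℝ * x} {x} λ n → ℚ.*-identityˡ (seq x n))
                   , (λ x → pointwise {x * 1ℝ} {x} λ n → ℚ.*-identityʳ (seq x n))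
      ; distrib = (λ x y z → pointwise {x * (y + z)} {x * y + x * z} λ n → ℚ.*-distribˡ-+ (seq x n) (seq y n) (seq z n))
                , (λ x y z → pointwise {(y + z) * x} {y * x + z * x} λ n → ℚ.*-distribʳ-+ (seq x n) (seq y n) (seq z n))
      }
    ; *-comm = λ x y → pointwise {x * y} {y * x} λ n → ℚ.*-comm (seq x n) (seq y n)
    }

  ≈0-stable : ∀ x → ¬ ¬ (x ≈ 0ℝ) → x ≈ 0ℝ
  ≈0-stable x ¬¬x≈0 = null⇒≈0 {x} (null-stable (cauchy x)
    (λ ¬null → ¬¬x≈0 (λ x≈0 → ¬null (≈0⇒null {x} x≈0))))

  noZeroDivisors : ∀ x y → x * y ≈ 0ℝ → ¬ (x ≈ 0ℝ) → y ≈ 0ℝ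
  noZeroDivisors x y xy≈0 x≉0 = null⇒≈0 {y} (null-*-cancel (cauchy y) (≈0⇒null {x * y} xy≈0)
    (λ null → x≉0 (null⇒≈0 {x} null)))

  nonNeg-resp-≈ : ∀ {x y} → x ≈ y → 0ℝ ≤ x → 0ℝ ≤ y
  nonNeg-resp-≈ {x} {y} x≈y 0≤x ε 0<ε with x≈y (½ ℚ.* ε) (½*-pos 0<ε) | 0≤x (½ ℚ.* ε) (½*-pos 0<ε)
  ... | M , near | N , low = M ⊔ N , λ n p → begin-strict
        0ℚ                                              <⟨ low n (ℕ.m⊔n≤o⇒n≤o M N p) ⟩
        seq x n ℚ.+ ½ ℚ.* ε
          ≡⟨ solve 3 (λ a b e → a :+ e := (b :+ e) :+ (a :- b)) refl (seq x n) (seq y n) (½ ℚ.* ε) ⟩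
        (seq y n ℚ.+ ½ ℚ.* ε) ℚ.+ (seq x n ℚ.- seq y n) ≤⟨ ℚ.+-monoʳ-≤ (seq y n ℚ.+ ½ ℚ.* ε) (p≤∣p∣ (seq x n ℚ.- seq y n)) ⟩
        (seq y n ℚ.+ ½ ℚ.* ε) ℚ.+ ℚ.∣ seq x n ℚ.- seq y n ∣ ≤⟨ ℚ.+-monoʳ-≤ (seq y n ℚ.+ ½ ℚ.* ε) (ℚ.<⇒≤ (near n (ℕ.m⊔n≤o⇒m≤o M N p))) ⟩
        (seq y n ℚ.+ ½ ℚ.* ε) ℚ.+ ½ ℚ.* ε               ≡⟨ trans (ℚ.+-assoc (seq y n) _ _) (cong (seq y n ℚ.+_) (½*+½* ε)) ⟩
        seq y n ℚ.+ ε                                   ∎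
    where
    open ℚ.≤-Reasoning
    p≤∣p∣ : ∀ p → p ℚ.≤ ℚ.∣ p ∣
    p≤∣p∣ p with ℚ.≤-total 0ℚ p
    ... | inj₁ 0≤p = ℚ.≤-reflexive (sym (ℚ.0≤p⇒∣p∣≡p 0≤p))
    ... | inj₂ p≤0 = ℚ.≤-trans p≤0 (ℚ.0≤∣p∣ p)

  nonNeg-+ : ∀ {x y} → 0ℝ ≤ x → 0ℝ ≤ y → 0ℝ ≤ x + y
  nonNeg-+ {x} {y} 0≤x 0≤y ε 0<ε with 0≤x (½ ℚ.* ε) (½*-pos 0<ε) | 0≤y (½ ℚ.* ε) (½*-pos 0<ε)
  ... | M , low-x | N , low-y = M ⊔ N , λ n p → begin-strict
        0ℚ
          <⟨ ℚ.+-mono-< (low-x n (ℕ.m⊔n≤o⇒m≤o M N p)) (low-y n (ℕ.m⊔n≤o⇒n≤o M N p)) ⟩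
        (seq x n ℚ.+ ½ ℚ.* ε) ℚ.+ (seq y n ℚ.+ ½ ℚ.* ε) ≡⟨ solve 3 (λ a b e → (a :+ e) :+ (b :+ e) := (a :+ b) :+ (e :+ e)) refl (seq x n) (seq y n) (½ ℚ.* ε) ⟩
        (seq x n ℚ.+ seq y n) ℚ.+ (½ ℚ.* ε ℚ.+ ½ ℚ.* ε) ≡⟨ cong (seq x n ℚ.+ seq y n ℚ.+_) (½*+½* ε) ⟩
        (seq x n ℚ.+ seq y n) ℚ.+ ε                     ∎
    where open ℚ.≤-Reasoning

  nonNeg-square : ∀ x → 0ℝ ≤ x * x
  nonNeg-square x ε 0<ε = 0 , λ n _ → ℚ.+-mono-≤-< (square≥0 (seq x n)) 0<ε
    where
    square≥0 : ∀ p → 0ℚ ℚ.≤ p ℚ.* p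
    square≥0 p with ℚ.≤-total 0ℚ p
    ... | inj₁ 0≤p = ℚ.nonNegative⁻¹ _ {{ℚ.nonNeg*nonNeg⇒nonNeg p {{ℚ.nonNegative 0≤p}} p {{ℚ.nonNegative 0≤p}}}}
    ... | inj₂ p≤0 = ℚ.nonNegative⁻¹ _ {{ℚ.nonPos*nonPos⇒nonPos p {{ℚ.nonPositive p≤0}} p {{ℚ.nonPositive p≤0}}}}

  nonNeg-antisym : ∀ {x} → 0ℝ ≤ x → 0ℝ ≤ - x → x ≈ 0ℝ
  nonNeg-antisym {x} 0≤x 0≤-x = null⇒≈0 {x} null
    where
    open ℚ.≤-Reasoning
    null : Null (seq x)
    null ε 0<ε with 0≤x ε 0<ε | 0≤-x ε 0<ε
    ... | M , low | N , low⁻ = M ⊔ N , small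
      where
      small : ∀ n → M ⊔ N ℕ.≤ n → ℚ.∣ seq x n ∣ ℚ.< ε
      small n p with ℚ.∣p∣≡p∨∣p∣≡-p (seq x n)
      ... | inj₁ e = begin-strict
        ℚ.∣ seq x n ∣                       ≡⟨ trans e (sym (ℚ.+-identityʳ (seq x n))) ⟩
        seq x n ℚ.+ 0ℚ                      <⟨ ℚ.+-monoʳ-< (seq x n) (low⁻ n (ℕ.m⊔n≤o⇒n≤o M N p)) ⟩
        seq x n ℚ.+ (ℚ.- seq x n ℚ.+ ε)     ≡⟨ solve 2 (λ a e → a :+ (:- a :+ e) := e) refl (seq x n) ε ⟩
        ε                                   ∎
      ... | inj₂ e = begin-strict
        ℚ.∣ seq x n ∣                       ≡⟨ trans e (sym (ℚ.+-identityʳ (ℚ.- seq x n))) ⟩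
        ℚ.- seq x n ℚ.+ 0ℚ                  <⟨ ℚ.+-monoʳ-< (ℚ.- seq x n) (low n (ℕ.m⊔n≤o⇒m≤o M N p)) ⟩
        ℚ.- seq x n ℚ.+ (seq x n ℚ.+ ε)     ≡⟨ solve 2 (λ a e → :- a :+ (a :+ e) := e) refl (seq x n) ε ⟩
        ε                                   ∎

  fromℚ-injective₀ : ∀ q → fromℚ q ≈ 0ℝ → q ≡ 0ℚ
  fromℚ-injective₀ q q≈0 with q ℚ.≟ 0ℚ
  ... | yes q≡0 = q≡0
  ... | no q≢0 with ℚ.<-cmp 0ℚ ℚ.∣ q ∣
  ...   | tri< 0<∣q∣ _ _ with ≈0⇒null {fromℚ q} q≈0 ℚ.∣ q ∣ 0<∣q∣
  ...     | N , small = contradiction (small N ℕ.≤-refl) (ℚ.<-irrefl refl)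
  fromℚ-injective₀ q q≈0 | no q≢0 | tri≈ _ 0≡∣q∣ _ = ℚ.∣p∣≡0⇒p≡0 q (sym 0≡∣q∣)
  fromℚ-injective₀ q q≈0 | no q≢0 | tri> _ _ ∣q∣<0 =
    contradiction (ℚ.≤-<-trans (ℚ.0≤∣p∣ q) ∣q∣<0) (ℚ.<-irrefl refl)

ℝ-isInvolutiveDomain : IsInvolutiveDomain ℝ-scalars
ℝ-isInvolutiveDomain = record
  { isCommutativeRing = isCommutativeRing
  ; conj-cong         = λ x≈y → x≈y
  ; conj-+            = λ x y → pointwise {x Real.+ y} {x Real.+ y} λ _ → refl
  ; conj-*            = λ x y → pointwise {x Real.* y} {x Real.* y} λ _ → refl
  ; conj-involutive   = λ x → pointwise {x} {x} λ _ → refl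
  ; ≈0-stable         = ≈0-stable
  ; noZeroDivisors    = noZeroDivisors
  ; nonNeg-resp-≈     = λ {x} {y} → nonNeg-resp-≈ {x} {y}
  ; nonNeg-+          = λ {x} {y} → nonNeg-+ {x} {y}
  ; nonNeg-norm       = nonNeg-square
  ; nonNeg-antisym    = λ {x} → nonNeg-antisym {x}
  ; conj-nonNeg       = λ {x} _ → pointwise {x} {x} λ _ → refl
  ; fromℚ             = Real.fromℚ
  ; fromℚ-0           = pointwise {Real.0ℝ} {Real.0ℝ} λ _ → refl
  ; fromℚ-+           = λ p q → pointwise {Real.fromℚ (p ℚ.+ q)} {Real.fromℚ p Real.+ Real.fromℚ q} λ _ → refl
  ; fromℚ-*           = λ p q → pointwise {Real.fromℚ (p ℚ.* q)} {Real.fromℚ p Real.* Real.fromℚ q} λ _ → refl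
  ; fromℚ-injective₀  = fromℚ-injective₀
  ; conj-fromℚ        = λ q → pointwise {Real.fromℚ q} {Real.fromℚ q} λ _ → refl
  }
  where open ℝ-Properties

-- The complex numbers as an involutive domain

module ℂ-Properties where
  open Complex
  open +-*-Solver
  private
    module ℝP = ℝ-Properties
    module R = IsCommutativeRing ℝP.isCommutativeRing

  pointwise : ∀ {z w} → (∀ n → seq (re z) n ≡ seq (re w) n) → (∀ n → seq (im z) n ≡ seq (im w) n) → z ≈ w
  pointwise {z} {w} p q = ℝP.pointwise {re z} {re w} p , ℝP.pointwise {im z} {im w} q

  +-cong : ∀ {x y u v} → x ≈ y → u ≈ v → x + u ≈ y + v
  +-cong {x} {y} {u} {v} (p , q) (r , s) =
    ℝP.+-cong {re x} {re y} {re u} {re v} p r , ℝP.+-cong {im x} {im y} {im u} {im v} q s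

  *-cong : ∀ {x y u v} → x ≈ y → u ≈ v → x * u ≈ y * v
  *-cong {x} {y} {u} {v} (p , q) (r , s) =
      ℝP.+-cong {re x Real.* re u} {re y Real.* re v} {Real.- (im x Real.* im u)} {Real.- (im y Real.* im v)}
        (ℝP.*-cong {re x} {re y} {re u} {re v} p r)
        (ℝP.-‿cong {im x Real.* im u} {im y Real.* im v} (ℝP.*-cong {im x} {im y} {im u} {im v} q s))
    , ℝP.+-cong {re x Real.* im u} {re y Real.* im v} {im x Real.* re u} {im y Real.* re v}
        (ℝP.*-cong {re x} {re y} {im u} {im v} p s)
        (ℝP.*-cong {im x} {im y} {re u} {re v} q r)

  -‿cong : ∀ {x y} → x ≈ y → - x ≈ - y
  -‿cong {x} {y} (p , q) = ℝP.-‿cong {re x} {re y} p , ℝP.-‿cong {im x} {im y} q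

  ≈-isEquivalence : IsEquivalence _≈_
  ≈-isEquivalence = record
    { refl  = λ {x} → R.refl {re x} , R.refl {im x}
    ; sym   = λ {x} {y} (p , q) → R.sym {re x} {re y} p , R.sym {im x} {im y} q
    ; trans = λ {x} {y} {z} (p , q) (r , s) → R.trans {re x} {re y} {re z} p r , R.trans {im x} {im y} {im z} q s
    }

  +-assoc : ∀ x y z → x + y + z ≈ x + (y + z)
  +-assoc x y z = R.+-assoc (re x) (re y) (re z) , R.+-assoc (im x) (im y) (im z)

  +-comm : ∀ x y → x + y ≈ y + x
  +-comm x y = R.+-comm (re x) (re y) , R.+-comm (im x) (im y)

  *-comm : ∀ x y → x * y ≈ y * x
  *-comm x y = pointwise {x * y} {y * x}
    (λ n → solve 4 (λ a b c d → a :* c :+ :- (b :* d) := c :* a :+ :- (d :* b)) refl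
      (seq (re x) n) (seq (im x) n) (seq (re y) n) (seq (im y) n))
    (λ n → solve 4 (λ a b c d → a :* d :+ b :* c := c :* b :+ d :* a) refl
      (seq (re x) n) (seq (im x) n) (seq (re y) n) (seq (im y) n))

  *-assoc : ∀ x y z → x * y * z ≈ x * (y * z)
  *-assoc x y z = pointwise {x * y * z} {x * (y * z)}
    (λ n → solve 6 (λ a b c d e f →
        (a :* c :+ :- (b :* d)) :* e :+ :- ((a :* d :+ b :* c) :* f) :=
        a :* (c :* e :+ :- (d :* f)) :+ :- (b :* (c :* f :+ d :* e))) refl
      (seq (re x) n) (seq (im x) n) (seq (re y) n) (seq (im y) n) (seq (re z) n) (seq (im z) n))
    (λ n → solve 6 (λ a b c d e f →
        (a :* c :+ :- (b :* d)) :* f :+ (a :* d :+ b :* c) :* e :=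
        a :* (c :* f :+ d :* e) :+ b :* (c :* e :+ :- (d :* f))) refl
      (seq (re x) n) (seq (im x) n) (seq (re y) n) (seq (im y) n) (seq (re z) n) (seq (im z) n))

  *-identityˡ : ∀ x → 1ℂ * x ≈ x
  *-identityˡ x = pointwise {1ℂ * x} {x}
    (λ n → solve 2 (λ a b → con 1ℚ :* a :+ :- (con 0ℚ :* b) := a) refl (seq (re x) n) (seq (im x) n))
    (λ n → solve 2 (λ a b → con 1ℚ :* b :+ con 0ℚ :* a := b) refl (seq (re x) n) (seq (im x) n))

  *-distribˡ-+ : ∀ x y z → x * (y + z) ≈ x * y + x * z
  *-distribˡ-+ x y z = pointwise {x * (y + z)} {x * y + x * z}
    (λ n → solve 6 (λ a b c d e f →
        a :* (c :+ e) :+ :- (b :* (d :+ f)) :=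
        (a :* c :+ :- (b :* d)) :+ (a :* e :+ :- (b :* f))) refl
      (seq (re x) n) (seq (im x) n) (seq (re y) n) (seq (im y) n) (seq (re z) n) (seq (im z) n))
    (λ n → solve 6 (λ a b c d e f →
        a :* (d :+ f) :+ b :* (c :+ e) :=
        (a :* d :+ b :* c) :+ (a :* f :+ b :* e)) refl
      (seq (re x) n) (seq (im x) n) (seq (re y) n) (seq (im y) n) (seq (re z) n) (seq (im z) n))

  open IsEquivalence ≈-isEquivalence using () renaming (trans to ≈-trans)

  isCommutativeRing : IsCommutativeRing _≈_ _+_ _*_ -_ 0ℂ 1ℂ
  isCommutativeRing = record
    { isRing = record
      { +-isAbelianGroup = record
        { isGroup = record
          { isMonoid = record
            { isSemigroup = record
              { isMagma = record { isEquivalence = ≈-isEquivalence ; ∙-cong = λ {x} {y} {u} {v} → +-cong {x} {y} {u} {v} }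
              ; assoc = +-assoc
              }
            ; identity = (λ x → R.+-identityˡ (re x) , R.+-identityˡ (im x))
                       , (λ x → R.+-identityʳ (re x) , R.+-identityʳ (im x))
            }
          ; inverse = (λ x → R.-‿inverseˡ (re x) , R.-‿inverseˡ (im x))
                    , (λ x → R.-‿inverseʳ (re x) , R.-‿inverseʳ (im x))
          ; ⁻¹-cong = λ {x} {y} → -‿cong {x} {y}
          }
        ; comm = +-comm
        }
      ; *-cong = λ {x} {y} {u} {v} → *-cong {x} {y} {u} {v}
      ; *-assoc = *-assoc
      ; *-identity = *-identityˡ
                   , (λ x → ≈-trans {x * 1ℂ} {1ℂ * x} {x} (*-comm x 1ℂ) (*-identityˡ x))
      ; distrib = *-distribˡ-+
                , (λ x y z → ≈-trans {(y + z) * x} {x * (y + z)} {y * x + z * x} (*-comm (y + z) x)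
                    (≈-trans {x * (y + z)} {x * y + x * z} {y * x + z * x} (*-distribˡ-+ x y z)
                      (+-cong {x * y} {y * x} {x * z} {z * x} (*-comm x y) (*-comm x z))))
      }
    ; *-comm = *-comm
    }

  norm : ℂ → ℝ
  norm z = re z Real.* re z Real.+ im z Real.* im z

  -- The two-square identity of Brahmagupta and Fibonacci, valid term by term. It carries the
  -- absence of zero divisors from ℝ to ℂ.
  norm-* : ∀ z w → norm (z * w) Real.≈ norm z Real.* norm w
  norm-* z w = ℝP.pointwise {norm (z * w)} {norm z Real.* norm w} λ n →
    solve 4 (λ a b c d →
        (a :* c :+ :- (b :* d)) :* (a :* c :+ :- (b :* d)) :+ (a :* d :+ b :* c) :* (a :* d :+ b :* c) :=
        (a :* a :+ b :* b) :* (c :* c :+ d :* d)) refl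
      (seq (re z) n) (seq (im z) n) (seq (re w) n) (seq (im w) n)

  square≈0 : ∀ x → x Real.* x Real.≈ Real.0ℝ → x Real.≈ Real.0ℝ
  square≈0 x x²≈0 = ℝP.≈0-stable x λ x≉0 → x≉0 (ℝP.noZeroDivisors x x x²≈0 x≉0)

  -- Since the squares add up to 0, -x² equals y² and is nonnegative along with x²; antisymmetry
  -- gives x² = 0.
  squares≈0 : ∀ x y → x Real.* x Real.+ y Real.* y Real.≈ Real.0ℝ → x Real.≈ Real.0ℝ
  squares≈0 x y sum≈0 = square≈0 x (ℝP.nonNeg-antisym {x²} (ℝP.nonNeg-square x)
    (ℝP.nonNeg-resp-≈ {y²} {Real.- x²}
      (null-resp-≗
        (λ n → solve 2 (λ a b → (a :+ b) :- con 0ℚ := b :- (:- a)) refl (seq x² n) (seq y² n))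
        sum≈0)
      (ℝP.nonNeg-square y)))
    where
    x² y² : ℝ
    x² = x Real.* x
    y² = y Real.* y

  norm≈0 : ∀ z → norm z Real.≈ Real.0ℝ → z ≈ 0ℂ
  norm≈0 z nz≈0 = squares≈0 (re z) (im z) nz≈0 ,
    squares≈0 (im z) (re z) (R.trans {im z Real.* im z Real.+ re z Real.* re z} {norm z} {Real.0ℝ}
      (R.+-comm (im z Real.* im z) (re z Real.* re z)) nz≈0)

  norm-cong₀ : ∀ z → z ≈ 0ℂ → norm z Real.≈ Real.0ℝ
  norm-cong₀ z (p , q) = R.trans {norm z} {norm 0ℂ} {Real.0ℝ}
    (ℝP.+-cong {re z Real.* re z} {Real.0ℝ Real.* Real.0ℝ} {im z Real.* im z} {Real.0ℝ Real.* Real.0ℝ}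
      (ℝP.*-cong {re z} {Real.0ℝ} {re z} {Real.0ℝ} p p) (ℝP.*-cong {im z} {Real.0ℝ} {im z} {Real.0ℝ} q q))
    (ℝP.pointwise {norm 0ℂ} {Real.0ℝ} λ _ → refl)

  noZeroDivisors : ∀ z w → z * w ≈ 0ℂ → ¬ (z ≈ 0ℂ) → w ≈ 0ℂ
  noZeroDivisors z w zw≈0 z≉0 = norm≈0 w (ℝP.noZeroDivisors (norm z) (norm w)
    (R.trans {norm z Real.* norm w} {norm (z * w)} {Real.0ℝ}
      (R.sym {norm (z * w)} {norm z Real.* norm w} (norm-* z w)) (norm-cong₀ (z * w) zw≈0))
    (λ nz≈0 → z≉0 (norm≈0 z nz≈0)))

ℂ-isInvolutiveDomain : IsInvolutiveDomain ℂ-scalars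
ℂ-isInvolutiveDomain = record
  { isCommutativeRing = isCommutativeRing
  ; conj-cong         = λ {x} {y} (p , q) → p , ℝP.-‿cong {im x} {im y} q
  ; conj-+            = λ x y → pointwise {conj (x + y)} {conj x + conj y}
      (λ _ → refl) (λ n → ℚ.neg-distrib-+ (seq (im x) n) (seq (im y) n))
  ; conj-*            = λ x y → pointwise {conj (x * y)} {conj x * conj y}
      (λ n → solve 4 (λ a b c d → a :* c :+ :- (b :* d) := a :* c :+ :- (:- b :* :- d)) refl
        (seq (re x) n) (seq (im x) n) (seq (re y) n) (seq (im y) n))
      (λ n → solve 4 (λ a b c d → :- (a :* d :+ b :* c) := a :* :- d :+ :- b :* c) refl
        (seq (re x) n) (seq (im x) n) (seq (re y) n) (seq (im y) n))
  ; conj-involutive   = λ x → pointwise {conj (conj x)} {x}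
      (λ _ → refl) (λ n → solve 1 (λ a → :- (:- a) := a) refl (seq (im x) n))
  ; ≈0-stable         = λ x ¬¬x≈0 →
        ℝP.≈0-stable (re x) (λ ¬p → ¬¬x≈0 (λ (p , _) → ¬p p))
      , ℝP.≈0-stable (im x) (λ ¬q → ¬¬x≈0 (λ (_ , q) → ¬q q))
  ; noZeroDivisors    = noZeroDivisors
  ; nonNeg-resp-≈     = λ {x} {y} (p , q) (0≤x , x-real) → ℝP.nonNeg-resp-≈ {re x} {re y} p 0≤x
      , R.trans {im y} {im x} {Real.0ℝ} (R.sym {im x} {im y} q) x-real
  ; nonNeg-+          = λ {x} {y} (0≤x , x-real) (0≤y , y-real) → ℝP.nonNeg-+ {re x} {re y} 0≤x 0≤y
      , R.trans {im x Real.+ im y} {Real.0ℝ Real.+ Real.0ℝ} {Real.0ℝ}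
          (ℝP.+-cong {im x} {Real.0ℝ} {im y} {Real.0ℝ} x-real y-real) (R.+-identityˡ Real.0ℝ)
  ; nonNeg-norm       = λ x →
        ℝP.nonNeg-resp-≈ {norm x} {re (conj x * x)}
          (ℝP.pointwise {norm x} {re (conj x * x)} λ n →
            solve 2 (λ a b → a :* a :+ b :* b := a :* a :+ :- (:- b :* b)) refl (seq (re x) n) (seq (im x) n))
          (ℝP.nonNeg-+ {re x Real.* re x} {im x Real.* im x} (ℝP.nonNeg-square (re x)) (ℝP.nonNeg-square (im x)))
      , ℝP.pointwise {im (conj x * x)} {Real.0ℝ} (λ n →
            solve 2 (λ a b → a :* b :+ :- b :* a := con 0ℚ) refl (seq (re x) n) (seq (im x) n))
  ; nonNeg-antisym    = λ {x} (0≤x , x-real) (0≤-x , _) → ℝP.nonNeg-antisym {re x} 0≤x 0≤-x , x-real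
  ; conj-nonNeg       = λ {x} (_ , x-real) → R.refl {re x} ,
      R.trans {Real.- im x} {Real.0ℝ} {im x}
        (R.trans {Real.- im x} {Real.- Real.0ℝ} {Real.0ℝ} (ℝP.-‿cong {im x} {Real.0ℝ} x-real)
          (ℝP.pointwise {Real.- Real.0ℝ} {Real.0ℝ} λ _ → refl))
        (R.sym {im x} {Real.0ℝ} x-real)
  ; fromℚ             = λ q → Real.fromℚ q +i Real.0ℝ
  ; fromℚ-0           = pointwise {0ℂ} {0ℂ} (λ _ → refl) (λ _ → refl)
  ; fromℚ-+           = λ p q → pointwise {Real.fromℚ (p ℚ.+ q) +i Real.0ℝ} {(Real.fromℚ p +i Real.0ℝ) + (Real.fromℚ q +i Real.0ℝ)}
      (λ _ → refl) (λ _ → refl)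
  ; fromℚ-*           = λ p q → pointwise {Real.fromℚ (p ℚ.* q) +i Real.0ℝ} {(Real.fromℚ p +i Real.0ℝ) * (Real.fromℚ q +i Real.0ℝ)}
      (λ _ → solve 2 (λ a b → a :* b := a :* b :+ :- (con 0ℚ :* con 0ℚ)) refl p q)
      (λ _ → solve 2 (λ a b → con 0ℚ := a :* con 0ℚ :+ con 0ℚ :* b) refl p q)
  ; fromℚ-injective₀  = λ q (p , _) → ℝP.fromℚ-injective₀ q p
  ; conj-fromℚ        = λ q → pointwise {conj (Real.fromℚ q +i Real.0ℝ)} {Real.fromℚ q +i Real.0ℝ}
      (λ _ → refl) (λ _ → refl)
  }
  where
  open Complex
  open ℂ-Properties
  open +-*-Solver
  module ℝP = ℝ-Properties
  module R = IsCommutativeRing ℝP.isCommutativeRing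

-- Positive semidefinite matrices

-- PSD zero forcing: if x lies in the kernel of a positive semidefinite
-- matrix with graph G and vanishes on Z, then it vanishes at every
-- forced vertex.  In contrast to the usual colour change rule, W need
-- not be a component of the graph induced on the unforced vertices.
data Forced {V : Set} (_~_ : Rel V 0ℓ) (Z : V → Set) : V → Set₁ where
  initial : ∀ {v} → Z v → Forced _~_ Z v
  force   : ∀ {u v} (W : V → Set) → W v → u ~ v → Forced _~_ Z u →
            (∀ {i j} → W i → ¬ W j → i ~ j → Forced _~_ Z j) →
            (∀ {j} → W j → u ~ j → j ≢ v → Forced _~_ Z j) →
            Forced _~_ Z v

-- The complement of the initial set is enumerated, not the set itself: its size bounds the rank
-- from below, and its vertices index the independent columns.
record ForcingComplement {n} (G : Graph n) (r : ℕ) : Set₁ where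
  field
    vertex    : Fin r → Fin n
    injective : Injective _≡_ _≡_ vertex
    forced    : ∀ v → Forced (Adj G) (λ w → ∀ k → vertex k ≢ w) v

open module ℚ-Sum = SemiringSum (CommutativeRing.semiring ℚ.+-*-commutativeRing)
  using () renaming (sum to sumℚ)

dot : ∀ {r} → Vector ℚ r → Vector ℚ r → ℚ
dot x y = sumℚ (λ k → x k ℚ.* y k)

record GramRepresentation {n} (G : Graph n) (r : ℕ) : Set where
  field
    vector      : Fin n → Vector ℚ r
    adjacent    : ∀ {i j} → Adj G i j → dot (vector i) (vector j) ≢ 0ℚ
    nonadjacent : ∀ {i j} → i ≢ j → ¬ Adj G i j → dot (vector i) (vector j) ≡ 0ℚ

-- Elimination over the rationals

*-≢0 : ∀ {p q} → p ≢ 0ℚ → q ≢ 0ℚ → p ℚ.* q ≢ 0ℚ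
*-≢0 {p} {q} p≢0 q≢0 pq≡0 = q≢0 (begin
  q                         ≡⟨ ℚ.*-identityˡ q ⟨
  1ℚ ℚ.* q                  ≡⟨ cong (ℚ._* q) (ℚ.*-inverseˡ p) ⟨
  (ℚ.1/ p) ℚ.* p ℚ.* q      ≡⟨ ℚ.*-assoc (ℚ.1/ p) p q ⟩
  (ℚ.1/ p) ℚ.* (p ℚ.* q)    ≡⟨ cong (ℚ.1/ p ℚ.*_) pq≡0 ⟩
  (ℚ.1/ p) ℚ.* 0ℚ           ≡⟨ ℚ.*-zeroʳ (ℚ.1/ p) ⟩
  0ℚ                        ∎)
  where
  open ≡-Reasoning
  instance
    p-nonZero : ℚ.NonZero p
    p-nonZero = ℚ.≢-nonZero p≢0

-- Gaussian elimination without division, one equation at a time. An equation without pivot holds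
-- for every vector and is dropped; otherwise the equation and the pivot's unknown are removed
-- together, which preserves r < s.
underdetermined : ∀ r s → r ℕ.< s → (A : Fin r → Vector ℚ s) →
  ∃[ c ] ((∃[ t ] c t ≢ 0ℚ) × (∀ k → dot (A k) c ≡ 0ℚ))
underdetermined zero    (suc s) _   A = (λ _ → 1ℚ) , (zero , ℚ.1≢0) , λ ()
underdetermined (suc r) (suc s) r<s A with Fin.any? (λ t → ¬? (A zero t ℚ.≟ 0ℚ))
... | no ∄pivot =
  let c , c≢0 , ker = underdetermined r (suc s) (ℕ.<-trans (ℕ.n<1+n r) r<s) (A ∘ suc)
  in c , c≢0 , λ { zero → vanish c ; (suc k) → ker k }
  where
  vanish : ∀ c → dot (A zero) c ≡ 0ℚ
  vanish c = trans
    (ℚ-Sum.sum-cong-≗ λ t → trans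
      (cong (ℚ._* c t) (decidable-stable (A zero t ℚ.≟ 0ℚ) λ A≢0 → ∄pivot (t , A≢0)))
      (ℚ.*-zeroˡ (c t)))
    (ℚ-Sum.sum-replicate-zero (suc s))
... | yes (p , a≢0) = eliminate (underdetermined r s (ℕ.s<s⁻¹ r<s) A′)
  where
  a : ℚ
  a = A zero p
  A′ : Fin r → Vector ℚ s
  -- Row `suc k` times the pivot, minus row 0 times the entry of row `suc k` in column p: the
  -- combination that clears column p.
  A′ k j = A (suc k) (punchIn p j) ℚ.* a ℚ.- A (suc k) p ℚ.* A zero (punchIn p j)

  eliminate : (∃[ c ] ((∃[ t ] c t ≢ 0ℚ) × (∀ k → dot (A′ k) c ≡ 0ℚ))) →
    ∃[ c ] ((∃[ t ] c t ≢ 0ℚ) × (∀ k → dot (A k) c ≡ 0ℚ))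
  eliminate (c′ , (t , c′t≢0) , ker) = c , (punchIn p t , ct≢0) , rows
    where
    -- The reduced solution is scaled by the pivot a, so that the removed unknown solves equation 0
    -- without a division by a.
    c₀ : ℚ
    c₀ = ℚ.- dot (A zero ∘ punchIn p) c′
    c : Vector ℚ (suc s)
    c = insertAt (λ j → a ℚ.* c′ j) p c₀

    ct≢0 : c (punchIn p t) ≢ 0ℚ
    ct≢0 = subst (_≢ 0ℚ) (sym (insertAt-punchIn (λ j → a ℚ.* c′ j) p c₀ t)) (*-≢0 a≢0 c′t≢0)

    open ≡-Reasoning
    open +-*-Solver

    expand : ∀ k → dot (A k) c ≡ dot (A k ∘ punchIn p) c′ ℚ.* a ℚ.- A k p ℚ.* dot (A zero ∘ punchIn p) c′
    expand k = begin
      dot (A k) c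
        ≡⟨ ℚ-Sum.sum-remove {i = p} (λ t → A k t ℚ.* c t) ⟩
      A k p ℚ.* c p ℚ.+ sumℚ (λ j → A k (punchIn p j) ℚ.* c (punchIn p j))
        ≡⟨ cong₂ ℚ._+_
             (cong (A k p ℚ.*_) (insertAt-lookup (λ j → a ℚ.* c′ j) p c₀))
             (ℚ-Sum.sum-cong-≗ λ j → trans
               (cong (A k (punchIn p j) ℚ.*_) (insertAt-punchIn (λ j → a ℚ.* c′ j) p c₀ j))
               (solve 3 (λ x y z → x :* (y :* z) := (x :* z) :* y) refl (A k (punchIn p j)) a (c′ j))) ⟩
      A k p ℚ.* c₀ ℚ.+ sumℚ (λ j → A k (punchIn p j) ℚ.* c′ j ℚ.* a)
        ≡⟨ cong (A k p ℚ.* c₀ ℚ.+_) (ℚ-Sum.*-distribʳ-sum a (λ j → A k (punchIn p j) ℚ.* c′ j)) ⟨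
      A k p ℚ.* c₀ ℚ.+ dot (A k ∘ punchIn p) c′ ℚ.* a
        ≡⟨ solve 4 (λ x d e y → x :* (:- d) :+ e :* y := e :* y :- x :* d) refl
             (A k p) (dot (A zero ∘ punchIn p) c′) (dot (A k ∘ punchIn p) c′) a ⟩
      dot (A k ∘ punchIn p) c′ ℚ.* a ℚ.- A k p ℚ.* dot (A zero ∘ punchIn p) c′ ∎

    rows : ∀ k → dot (A k) c ≡ 0ℚ
    rows zero = trans (expand zero)
      (solve 2 (λ d y → d :* y :- y :* d := con 0ℚ) refl (dot (A zero ∘ punchIn p) c′) a)
    rows (suc k) = begin
      dot (A (suc k)) c
        ≡⟨ expand (suc k) ⟩
      dot (A (suc k) ∘ punchIn p) c′ ℚ.* a ℚ.- b ℚ.* dot (A zero ∘ punchIn p) c′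
        ≡⟨ solve 4 (λ d y x e → d :* y :- x :* e := d :* y :+ e :* (:- x)) refl
             (dot (A (suc k) ∘ punchIn p) c′) a b (dot (A zero ∘ punchIn p) c′) ⟩
      dot (A (suc k) ∘ punchIn p) c′ ℚ.* a ℚ.+ dot (A zero ∘ punchIn p) c′ ℚ.* (ℚ.- b)
        ≡⟨ cong₂ ℚ._+_ (ℚ-Sum.*-distribʳ-sum a (λ j → A (suc k) (punchIn p j) ℚ.* c′ j))
             (ℚ-Sum.*-distribʳ-sum (ℚ.- b) (λ j → A zero (punchIn p j) ℚ.* c′ j)) ⟩
      sumℚ (λ j → A (suc k) (punchIn p j) ℚ.* c′ j ℚ.* a) ℚ.+ sumℚ (λ j → A zero (punchIn p j) ℚ.* c′ j ℚ.* (ℚ.- b))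
        ≡⟨ ℚ-Sum.∑-distrib-+ (λ j → A (suc k) (punchIn p j) ℚ.* c′ j ℚ.* a) (λ j → A zero (punchIn p j) ℚ.* c′ j ℚ.* (ℚ.- b)) ⟨
      sumℚ (λ j → A (suc k) (punchIn p j) ℚ.* c′ j ℚ.* a ℚ.+ A zero (punchIn p j) ℚ.* c′ j ℚ.* (ℚ.- b))
        ≡⟨ ℚ-Sum.sum-cong-≗ (λ j → solve 5 (λ x z y w v → x :* z :* y :+ w :* z :* (:- v) := (x :* y :- v :* w) :* z) refl
             (A (suc k) (punchIn p j)) (c′ j) a (A zero (punchIn p j)) b) ⟩
      dot (A′ k) c′
        ≡⟨ ker k ⟩
      0ℚ ∎
      where
      b : ℚ
      b = A (suc k) p

-- Identities in commutative rings

module RingIdentities (R : CommutativeRing 0ℓ 0ℓ) where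

  open CommutativeRing R renaming (refl to ≈-refl; sym to ≈-sym; trans to ≈-trans)
  open RingProperties ring using (-‿distribʳ-*)
  open NaturalCoefficients commutativeSemiring

  linear-*ˡ : ∀ c p a q b → c * (p * a + q * b) ≈ p * (c * a) + q * (c * b)
  linear-*ˡ = solve 5 (λ c p a q b → c :* (p :* a :+ q :* b) := p :* (c :* a) :+ q :* (c :* b)) ≈-refl

  linear-*ʳ : ∀ c p a q b → (p * a + q * b) * c ≈ p * (a * c) + q * (b * c)
  linear-*ʳ = solve 5 (λ c p a q b → (p :* a :+ q :* b) :* c := p :* (a :* c) :+ q :* (b :* c)) ≈-refl

  *-reverse : ∀ a b c → a * (b * c) ≈ c * (b * a)
  *-reverse = solve 3 (λ a b c → a :* (b :* c) := c :* (b :* a)) ≈-refl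

  *-swap : ∀ a b c → a * (b * c) ≈ b * (a * c)
  *-swap = solve 3 (λ a b c → a :* (b :* c) := b :* (a :* c)) ≈-refl

  *-rotate : ∀ a b c → a * (b * c) ≈ b * (c * a)
  *-rotate = solve 3 (λ a b c → a :* (b :* c) := b :* (c :* a)) ≈-refl

  *-regroup : ∀ a b c d → a * (b * c * d) ≈ (a * b) * (c * d)
  *-regroup = solve 4 (λ a b c d → a :* (b :* c :* d) := (a :* b) :* (c :* d)) ≈-refl

  +-cancelled : ∀ a b → (a + b) + - b ≈ a
  +-cancelled a b = ≈-trans (+-assoc a b (- b)) (≈-trans (+-congˡ (-‿inverseʳ b)) (+-identityʳ a))

  -- On the left stand the values of the form at (b + 1)y - aw and at aw in `psd-isotropic`, plus
  -- a². In `collect` an independent variable q replaces -a, so that a semiring identity suffices;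
  -- the terms with the factor q + a then vanish and only aq = -a² remains.
  test-vectors : ∀ a b →
    (((b + 1#) * (- a * a) + - a * ((b + 1#) * a + - a * b)) + (0# * (a * a) + a * (0# * a + a * b))) + a * a
    ≈ - (a * a)
  test-vectors a b = ≈-trans (collect a b (- a))
    (≈-trans (+-cong (≈-trans (*-congʳ (-‿inverseˡ a)) (zeroˡ _)) (≈-sym (-‿distribʳ-* a a))) (+-identityˡ (- (a * a))))
    where
    collect : ∀ a b q →
      (((b + 1#) * (q * a) + q * ((b + 1#) * a + q * b)) + (0# * (a * a) + a * (0# * a + a * b))) + a * a
      ≈ (q + a) * (b * (q + a) + a) + a * q
    collect = solve 3 (λ a b q →
      (((b :+ con 1) :* (q :* a) :+ q :* ((b :+ con 1) :* a :+ q :* b)) :+ (con 0 :* (a :* a) :+ a :* (con 0 :* a :+ a :* b))) :+ a :* a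
      := (q :+ a) :* (b :* (q :+ a) :+ a) :+ a :* q) ≈-refl

-- Hermitian forms, forcing and Gram matrices over ℝ and ℂ

module LinearAlgebra {𝕂 : Scalars} (isInvolutiveDomain : IsInvolutiveDomain 𝕂) where

  open Scalars 𝕂
  open PSD 𝕂
  open IsInvolutiveDomain isInvolutiveDomain
  open IsCommutativeRing isCommutativeRing
    using (+-cong; +-congˡ; +-congʳ; *-cong; *-congˡ; *-congʳ; *-comm; +-comm
          ; +-identityˡ; +-identityʳ; *-identityˡ; *-identityʳ; zeroˡ; zeroʳ; -‿inverseˡ)
    renaming (refl to ≈-refl; sym to ≈-sym; trans to ≈-trans)

  commutativeRing : CommutativeRing 0ℓ 0ℓ
  commutativeRing = record { isCommutativeRing = isCommutativeRing }

  open RingIdentities commutativeRing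
  open SemiringSum (CommutativeRing.semiring commutativeRing)
    using (sum; sum-cong-≋; sum-replicate-zero; sum-remove; ∑-distrib-+; ∑-comm; *-distribˡ-sum; *-distribʳ-sum)
  open SetoidReasoning (CommutativeRing.setoid commutativeRing)

  sum-zero : ∀ {n} (f : Vector Carrier n) → (∀ i → f i ≈ 0#) → sum f ≈ 0#
  sum-zero {n} f f≈0 = ≈-trans (sum-cong-≋ f≈0) (sum-replicate-zero n)

  sum-single : ∀ {n} (f : Vector Carrier n) i → (∀ j → j ≢ i → f j ≈ 0#) → sum f ≈ f i
  sum-single {suc n} f i f≈0 = begin
    sum f                          ≈⟨ sum-remove {i = i} f ⟩
    f i + sum (f ∘ punchIn i)
      ≈⟨ +-congˡ (sum-zero (f ∘ punchIn i) λ j → f≈0 (punchIn i j) (Fin.punchInᵢ≢i i j)) ⟩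
    f i + 0#                       ≈⟨ +-identityʳ (f i) ⟩
    f i                            ∎

  conj-0# : conj 0# ≈ 0#
  conj-0# = ≈-trans (conj-cong (≈-sym fromℚ-0)) (≈-trans (conj-fromℚ 0ℚ) fromℚ-0)

  conj-1# : conj 1# ≈ 1#
  conj-1# = begin
    conj 1#                 ≈⟨ *-identityˡ (conj 1#) ⟨
    1# * conj 1#            ≈⟨ *-congʳ (conj-involutive 1#) ⟨
    conj (conj 1#) * conj 1# ≈⟨ conj-* (conj 1#) 1# ⟨
    conj (conj 1# * 1#)     ≈⟨ conj-cong (*-identityʳ (conj 1#)) ⟩
    conj (conj 1#)          ≈⟨ conj-involutive 1# ⟩
    1#                      ∎

  conj-sum : ∀ {n} (f : Vector Carrier n) → conj (sum f) ≈ sum (conj ∘ f)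
  conj-sum {zero}  f = conj-0#
  conj-sum {suc n} f = ≈-trans (conj-+ (f zero) (sum (f ∘ suc))) (+-congˡ (conj-sum (f ∘ suc)))

  infix 8 ⟨_,_⟩
  infixr 7 _·_

  ⟨_,_⟩ : ∀ {n} → Vector Carrier n → Vector Carrier n → Carrier
  ⟨ x , y ⟩ = sum λ i → conj (x i) * y i

  _·_ : ∀ {n} → Matrix n → Vector Carrier n → Vector Carrier n
  (A · x) i = sum λ j → A i j * x j

  linear : ∀ {n} → Carrier → Vector Carrier n → Carrier → Vector Carrier n → Vector Carrier n
  linear p x q y i = p * x i + q * y i

  sum-linear : ∀ {n} p q (f g : Vector Carrier n) → sum (linear p f q g) ≈ p * sum f + q * sum g
  sum-linear p q f g = ≈-trans (∑-distrib-+ (λ i → p * f i) (λ i → q * g i))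
    (≈-sym (+-cong (*-distribˡ-sum p f) (*-distribˡ-sum q g)))

  ⟨⟩-congʳ : ∀ {n} (x : Vector Carrier n) {y z} → (∀ i → y i ≈ z i) → ⟨ x , y ⟩ ≈ ⟨ x , z ⟩
  ⟨⟩-congʳ x y≈z = sum-cong-≋ λ i → *-congˡ (y≈z i)

  ⟨⟩-linearʳ : ∀ {n} p q (z x y : Vector Carrier n) →
    ⟨ z , linear p x q y ⟩ ≈ p * ⟨ z , x ⟩ + q * ⟨ z , y ⟩
  ⟨⟩-linearʳ p q z x y = ≈-trans
    (sum-cong-≋ λ i → linear-*ˡ (conj (z i)) p (x i) q (y i))
    (sum-linear p q (λ i → conj (z i) * x i) (λ i → conj (z i) * y i))

  ⟨⟩-linearˡ : ∀ {n} {p q} → conj p ≈ p → conj q ≈ q → (x y z : Vector Carrier n) →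
    ⟨ linear p x q y , z ⟩ ≈ p * ⟨ x , z ⟩ + q * ⟨ y , z ⟩
  ⟨⟩-linearˡ {p = p} {q} p-real q-real x y z = ≈-trans
    (sum-cong-≋ λ i → ≈-trans
      (*-congʳ (≈-trans (conj-+ (p * x i) (q * y i)) (+-cong
        (≈-trans (conj-* p (x i)) (*-congʳ p-real)) (≈-trans (conj-* q (y i)) (*-congʳ q-real)))))
      (linear-*ʳ (z i) p (conj (x i)) q (conj (y i))))
    (sum-linear p q (λ i → conj (x i) * z i) (λ i → conj (y i) * z i))

  ·-linear : ∀ {n} (A : Matrix n) p q (x y : Vector Carrier n) i →
    (A · linear p x q y) i ≈ linear p (A · x) q (A · y) i
  ·-linear A p q x y i = ≈-trans
    (sum-cong-≋ λ j → linear-*ˡ (A i j) p (x j) q (y j))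
    (sum-linear p q (λ j → A i j * x j) (λ j → A i j * y j))

  ⟨⟩-hermitian : ∀ {n} (A : Matrix n) → IsHermitian A → ∀ x y → conj ⟨ x , A · y ⟩ ≈ ⟨ y , A · x ⟩
  ⟨⟩-hermitian A A-herm x y = begin
    conj ⟨ x , A · y ⟩
      ≈⟨ conj-sum (λ i → conj (x i) * (A · y) i) ⟩
    sum (λ i → conj (conj (x i) * (A · y) i))
      ≈⟨ sum-cong-≋ (λ i → begin
           conj (conj (x i) * (A · y) i)          ≈⟨ conj-* (conj (x i)) ((A · y) i) ⟩
           conj (conj (x i)) * conj ((A · y) i)
             ≈⟨ *-cong (conj-involutive (x i)) (conj-sum (λ j → A i j * y j)) ⟩
           x i * sum (λ j → conj (A i j * y j))   ≈⟨ *-distribˡ-sum (x i) (λ j → conj (A i j * y j)) ⟩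
           sum (λ j → x i * conj (A i j * y j))   ≈⟨ sum-cong-≋ (λ j → ≈-trans
             (*-congˡ (≈-trans (conj-* (A i j) (y j)) (*-congʳ (≈-sym (A-herm j i)))))
             (*-reverse (x i) (A j i) (conj (y j)))) ⟩
           sum (λ j → conj (y j) * (A j i * x i)) ∎) ⟩
    sum (λ i → sum (λ j → conj (y j) * (A j i * x i)))
      ≈⟨ ∑-comm (λ i j → conj (y j) * (A j i * x i)) ⟩
    sum (λ j → sum (λ i → conj (y j) * (A j i * x i)))
      ≈⟨ sum-cong-≋ (λ j → ≈-sym (*-distribˡ-sum (conj (y j)) (λ i → A j i * x i))) ⟩
    ⟨ y , A · x ⟩ ∎

  nonNeg-sum : ∀ {n} (f : Vector Carrier n) → (∀ i → NonNegative (f i)) → NonNegative (sum f)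
  -- Nonnegativity of 0 is read off from the norm of 0.
  nonNeg-sum {zero}  f f≥0 = nonNeg-resp-≈ (zeroʳ (conj 0#)) (nonNeg-norm 0#)
  nonNeg-sum {suc n} f f≥0 = nonNeg-+ (f≥0 zero) (nonNeg-sum (f ∘ suc) (f≥0 ∘ suc))

  psd-form : ∀ {n} {A : Matrix n} → IsPSD A → ∀ x → NonNegative ⟨ x , A · x ⟩
  psd-form {A = A} (_ , A≥0) x = nonNeg-resp-≈
    (sum-cong-≋ λ i → ≈-sym (*-distribˡ-sum (conj (x i)) (λ j → A i j * x j))) (A≥0 x)

  norm≈0 : ∀ x → conj x * x ≈ 0# → x ≈ 0#
  norm≈0 x xx≈0 = ≈0-stable x λ x≉0 → x≉0 (noZeroDivisors (conj x) x xx≈0 λ conj-x≈0 →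
    x≉0 (≈-trans (≈-sym (conj-involutive x)) (≈-trans (conj-cong conj-x≈0) conj-0#)))

  nonNeg-cancel : ∀ {x y} → NonNegative x → NonNegative y → x + y ≈ 0# → x ≈ 0#
  nonNeg-cancel {x} {y} x≥0 y≥0 x+y≈0 = nonNeg-antisym x≥0 (nonNeg-resp-≈ y≈-x y≥0)
    where
    y≈-x : y ≈ - x
    y≈-x = ≈-trans (≈-sym (+-cancelled y x)) (≈-trans (+-congʳ (≈-trans (+-comm y x) x+y≈0)) (+-identityˡ (- x)))

  nonNeg-sum≈0 : ∀ {n} (f : Vector Carrier n) → (∀ i → NonNegative (f i)) → sum f ≈ 0# → ∀ i → f i ≈ 0#
  nonNeg-sum≈0 f f≥0 sum≈0 zero = nonNeg-cancel (f≥0 zero) (nonNeg-sum (f ∘ suc) (f≥0 ∘ suc)) sum≈0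
  nonNeg-sum≈0 f f≥0 sum≈0 (suc i) = nonNeg-sum≈0 (f ∘ suc) (f≥0 ∘ suc)
    (nonNeg-cancel (nonNeg-sum (f ∘ suc) (f≥0 ∘ suc)) (f≥0 zero)
      (≈-trans (+-comm (sum (f ∘ suc)) (f zero)) sum≈0)) i

  -- Put w = Ay, a = ⟨w,w⟩ and b = ⟨w,Aw⟩.  Testing A on (b + 1)y − aw
  -- gives −2a²(b + 1) + a²b ≥ 0; adding a²b = ⟨aw,Aaw⟩ ≥ 0 leaves −2a² ≥ 0.
  psd-isotropic : ∀ {n} {A : Matrix n} → IsPSD A → ∀ y → ⟨ y , A · y ⟩ ≈ 0# → ∀ i → (A · y) i ≈ 0#
  psd-isotropic {n} {A} A-psd y isotropic i =
    norm≈0 (w i) (nonNeg-sum≈0 (λ k → conj (w k) * w k) (λ k → nonNeg-norm (w k)) a≈0 i)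
    where
    w : Vector Carrier n
    w = A · y
    a b p : Carrier
    a = ⟨ w , w ⟩
    b = ⟨ w , A · w ⟩
    p = b + 1#

    a≥0 : NonNegative a
    a≥0 = nonNeg-sum _ λ k → nonNeg-norm (w k)
    b≥0 : NonNegative b
    b≥0 = psd-form A-psd w
    a-real : conj a ≈ a
    a-real = conj-nonNeg a≥0
    p-real : conj p ≈ p
    p-real = ≈-trans (conj-+ b 1#) (+-cong (conj-nonNeg b≥0) conj-1#)
    -a-real : conj (- a) ≈ - a
    -a-real = begin
      conj (- a)                  ≈⟨ +-cancelled (conj (- a)) a ⟨
      (conj (- a) + a) + - a      ≈⟨ +-congʳ (+-congˡ a-real) ⟨
      (conj (- a) + conj a) + - a ≈⟨ +-congʳ (conj-+ (- a) a) ⟨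
      conj (- a + a) + - a        ≈⟨ +-congʳ (conj-cong (-‿inverseˡ a)) ⟩
      conj 0# + - a               ≈⟨ +-congʳ conj-0# ⟩
      0# + - a                    ≈⟨ +-identityˡ (- a) ⟩
      - a                         ∎

    form : ∀ {p q} → conj p ≈ p → conj q ≈ q →
      ⟨ linear p y q w , A · linear p y q w ⟩ ≈ p * (q * a) + q * (p * a + q * b)
    form {p} {q} p-real q-real = begin
      ⟨ linear p y q w , A · linear p y q w ⟩
        ≈⟨ ⟨⟩-congʳ (linear p y q w) (·-linear A p q y w) ⟩
      ⟨ linear p y q w , linear p w q (A · w) ⟩
        ≈⟨ ⟨⟩-linearˡ p-real q-real y w (linear p w q (A · w)) ⟩
      p * ⟨ y , linear p w q (A · w) ⟩ + q * ⟨ w , linear p w q (A · w) ⟩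
        ≈⟨ +-cong (*-congˡ (⟨⟩-linearʳ p q y w (A · w))) (*-congˡ (⟨⟩-linearʳ p q w w (A · w))) ⟩
      p * (p * ⟨ y , w ⟩ + q * ⟨ y , A · w ⟩) + q * (p * a + q * b)
        ≈⟨ +-congʳ (*-congˡ (+-cong (≈-trans (*-congˡ isotropic) (zeroʳ p))
             (*-congˡ (≈-trans (≈-sym (⟨⟩-hermitian A (proj₁ A-psd) w y)) a-real)))) ⟩
      p * (0# + q * a) + q * (p * a + q * b)
        ≈⟨ +-congʳ (*-congˡ (+-identityˡ (q * a))) ⟩
      p * (q * a) + q * (p * a + q * b) ∎

    a²≥0 : NonNegative (a * a)
    a²≥0 = nonNeg-resp-≈ (*-congʳ a-real) (nonNeg-norm a)

    -a²≥0 : NonNegative (- (a * a))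
    -a²≥0 = nonNeg-resp-≈ (test-vectors a b)
      (nonNeg-+ (nonNeg-+ (nonNeg-resp-≈ (form p-real -a-real) (psd-form A-psd (linear p y (- a) w)))
                          (nonNeg-resp-≈ (form conj-0# a-real) (psd-form A-psd (linear 0# y a w))))
                a²≥0)

    a≈0 : a ≈ 0#
    a≈0 = norm≈0 a (≈-trans (*-congʳ a-real) (nonNeg-antisym a²≥0 -a²≥0))

  -- The set W of a forcing step is an arbitrary predicate. As double negation commutes with finite
  -- products, W may be taken as decidable in the proof of any stable statement, such as x v ≈ 0.
  ¬¬-decidable : ∀ {n} (P : Fin n → Set) → ¬ ¬ (∀ i → Dec (P i))
  ¬¬-decidable P = Fin.sequence (RawMonad.rawApplicative ¬¬-Monad) (λ _ → ¬¬-excluded-middle)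

  module _ {n} {G : Graph n} {A : Matrix n} (A-psd : IsPSD A) (A-graph : HasGraph A G) where

    nonadjacent≈0 : ∀ {i j} → i ≢ j → ¬ Adj G i j → A i j ≈ 0#
    nonadjacent≈0 {i} {j} i≢j ¬ij = ≈0-stable (A i j) λ Aij≉0 → ¬ij (Equivalence.to (A-graph i j) (i≢j , Aij≉0))

    -- Let y be x truncated to W. For i in W, row i of A takes the same value 0 on y as on x,
    -- because edges leaving W end at forced vertices, where x vanishes; for i outside W the
    -- coordinate of y is 0. So ⟨y, Ay⟩ = 0, and positivity upgrades this to Ay = 0 in every row. In
    -- row u only the term of v survives, so A u v times x v is 0.
    forced≈0 : ∀ {Z} (x : Vector Carrier n) → (∀ i → (A · x) i ≈ 0#) → (∀ {v} → Z v → x v ≈ 0#) →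
      ∀ {v} → Forced (Adj G) Z v → x v ≈ 0#
    forced≈0 x Ax≈0 Z≈0 (initial z) = Z≈0 z
    forced≈0 {Z} x Ax≈0 Z≈0 (force {u} {v} W v∈W uv u-forced boundary neighbours) =
      ≈0-stable (x v) λ x≉0 → ¬¬-decidable W λ W? → x≉0 (x≈0 W?)
      where
      module _ (W? : ∀ i → Dec (W i)) where
        y : Vector Carrier n
        y i = if does (W? i) then x i else 0#

        term-in-W : ∀ {i} → W i → ∀ j → A i j * y j ≈ A i j * x j
        term-in-W {i} i∈W j with W? j
        ... | yes _ = ≈-refl
        ... | no j∉W with adj? G i j
        ...   | yes ij = *-congˡ (≈-sym (forced≈0 x Ax≈0 Z≈0 (boundary i∈W j∉W ij)))
        ...   | no ¬ij = ≈-trans (zeroʳ (A i j))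
          (≈-sym (≈-trans (*-congʳ (nonadjacent≈0 (λ { refl → j∉W i∈W }) ¬ij)) (zeroˡ (x j))))

        isotropic : ⟨ y , A · y ⟩ ≈ 0#
        isotropic = sum-zero _ zero-term
          where
          zero-term : ∀ i → conj (y i) * (A · y) i ≈ 0#
          zero-term i with W? i
          ... | yes i∈W = ≈-trans (*-congˡ (≈-trans (sum-cong-≋ (term-in-W i∈W)) (Ax≈0 i))) (zeroʳ (conj (x i)))
          ... | no _ = ≈-trans (*-congʳ conj-0#) (zeroˡ _)

        term-of-u : ∀ j → j ≢ v → A u j * y j ≈ 0#
        term-of-u j j≢v with W? j
        ... | no _ = zeroʳ (A u j)
        ... | yes j∈W with u Fin.≟ j
        ...   | yes refl = ≈-trans (*-congˡ (forced≈0 x Ax≈0 Z≈0 u-forced)) (zeroʳ (A u j))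
        ...   | no u≢j with adj? G u j
        ...     | yes uj = ≈-trans (*-congˡ (forced≈0 x Ax≈0 Z≈0 (neighbours j∈W uj j≢v))) (zeroʳ (A u j))
        ...     | no ¬uj = ≈-trans (*-congʳ (nonadjacent≈0 u≢j ¬uj)) (zeroˡ (x j))

        y≈x : y v ≈ x v
        y≈x with W? v
        ... | yes _ = ≈-refl
        ... | no v∉W = contradiction v∈W v∉W

        x≈0 : x v ≈ 0#
        x≈0 = noZeroDivisors (A u v) (x v)
          (begin
            A u v * x v                ≈⟨ *-congˡ y≈x ⟨
            A u v * y v                ≈⟨ sum-single (λ j → A u j * y j) v term-of-u ⟨
            (A · y) u                  ≈⟨ psd-isotropic A-psd y isotropic u ⟩
            0#                         ∎)
          (proj₂ (Equivalence.from (A-graph u v) uv))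

    -- A dependence among the chosen columns, extended by 0, is a kernel vector supported outside
    -- the forcing set, hence zero everywhere. Injectivity of `vertex` lets each coefficient be read
    -- off as a coordinate.
    forcing⇒independent : ∀ {r} (F : ForcingComplement G r) →
      LinearlyIndependent (column A ∘ ForcingComplement.vertex F)
    forcing⇒independent F c dependence k = ≈-trans (≈-sym (x-vertex k))
      (forced≈0 x Ax≈0 (λ v∉F → sum-zero _ λ l → ≈-trans (*-congˡ (δ-≢ (v∉F l))) (zeroʳ (c l))) (forced (vertex k)))
      where
      open ForcingComplement F

      δ : Fin n → Fin n → Carrier
      δ i j = if does (i Fin.≟ j) then 1# else 0#

      δ-≢ : ∀ {i j} → i ≢ j → δ i j ≈ 0#
      δ-≢ {i} {j} i≢j with i Fin.≟ j
      ... | yes i≡j = contradiction i≡j i≢j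
      ... | no _    = ≈-refl

      δ-refl : ∀ i → δ i i ≈ 1#
      δ-refl i with i Fin.≟ i
      ... | yes _  = ≈-refl
      ... | no i≢i = contradiction refl i≢i

      x : Vector Carrier n
      x v = sum λ l → c l * δ (vertex l) v

      x-vertex : ∀ k → x (vertex k) ≈ c k
      x-vertex k = begin
        x (vertex k)
          ≈⟨ sum-single _ k (λ l l≢k → ≈-trans (*-congˡ (δ-≢ (λ e → l≢k (injective e)))) (zeroʳ (c l))) ⟩
        c k * δ (vertex k) (vertex k)   ≈⟨ *-congˡ (δ-refl (vertex k)) ⟩
        c k * 1#                        ≈⟨ *-identityʳ (c k) ⟩
        c k                             ∎

      Ax≈0 : ∀ i → (A · x) i ≈ 0#
      Ax≈0 i = begin
        sum (λ v → A i v * x v)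
          ≈⟨ sum-cong-≋ (λ v → ≈-trans (*-distribˡ-sum (A i v) (λ l → c l * δ (vertex l) v))
               (sum-cong-≋ λ l → *-swap (A i v) (c l) (δ (vertex l) v))) ⟩
        sum (λ v → sum (λ l → c l * (A i v * δ (vertex l) v)))
          ≈⟨ ∑-comm (λ v l → c l * (A i v * δ (vertex l) v)) ⟩
        sum (λ l → sum (λ v → c l * (A i v * δ (vertex l) v)))
          ≈⟨ sum-cong-≋ (λ l → begin
               sum (λ v → c l * (A i v * δ (vertex l) v))
                 ≈⟨ sum-single _ (vertex l) (λ v v≢l → ≈-trans (*-congˡ
                      (≈-trans (*-congˡ (δ-≢ (λ e → v≢l (sym e)))) (zeroʳ (A i v)))) (zeroʳ (c l))) ⟩
               c l * (A i (vertex l) * δ (vertex l) (vertex l))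
                 ≈⟨ *-congˡ (≈-trans (*-congˡ (δ-refl (vertex l))) (*-identityʳ (A i (vertex l)))) ⟩
               c l * A i (vertex l) ∎) ⟩
        sum (λ l → c l * A i (vertex l))
          ≈⟨ dependence i ⟩
        0# ∎

  fromℚ-cong : ∀ {p q} → p ≡ q → fromℚ p ≈ fromℚ q
  fromℚ-cong refl = ≈-refl

  fromℚ-sum : ∀ {n} (f : Vector ℚ n) → fromℚ (sumℚ f) ≈ sum (fromℚ ∘ f)
  fromℚ-sum {zero}  f = fromℚ-0
  fromℚ-sum {suc n} f = ≈-trans (fromℚ-+ (f zero) (sumℚ (f ∘ suc))) (+-congˡ (fromℚ-sum (f ∘ suc)))

  gram : ∀ {n r} → (Fin n → Vector ℚ r) → Matrix n
  gram u i j = fromℚ (dot (u i) (u j))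

  gram-expand : ∀ {n r} (u : Fin n → Vector ℚ r) i j → gram u i j ≈ sum λ k → fromℚ (u i k) * fromℚ (u j k)
  gram-expand u i j = ≈-trans (fromℚ-sum (λ k → u i k ℚ.* u j k))
    (sum-cong-≋ λ k → fromℚ-* (u i k) (u j k))

  -- With U the matrix of rows `u i`, the Gram matrix is U times its transpose, and the form at x is
  -- the norm of y, the transpose of U applied to x.
  gram-psd : ∀ {n r} (u : Fin n → Vector ℚ r) → IsPSD (gram u)
  gram-psd {n} {r} u = hermitian , λ x → nonNeg-resp-≈ (≈-sym (form x))
      (nonNeg-sum _ λ k → nonNeg-norm (y x k))
    where
    hermitian : IsHermitian (gram u)
    hermitian i j = ≈-trans
      (fromℚ-cong (ℚ-Sum.sum-cong-≗ λ k → ℚ.*-comm (u i k) (u j k)))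
      (≈-sym (conj-fromℚ (dot (u j) (u i))))

    y : Vector Carrier n → Vector Carrier r
    y x k = sum λ j → fromℚ (u j k) * x j

    conj-y : ∀ x k → conj (y x k) ≈ sum λ i → conj (x i) * fromℚ (u i k)
    conj-y x k = ≈-trans (conj-sum (λ j → fromℚ (u j k) * x j)) (sum-cong-≋ λ i →
      ≈-trans (conj-* (fromℚ (u i k)) (x i))
        (≈-trans (*-congʳ (conj-fromℚ (u i k))) (*-comm (fromℚ (u i k)) (conj (x i)))))

    form : ∀ x → (sum λ i → sum λ j → conj (x i) * (gram u i j * x j)) ≈ ⟨ y x , y x ⟩
    form x = begin
      sum (λ i → sum (λ j → conj (x i) * (gram u i j * x j)))
        ≈⟨ sum-cong-≋ (λ i → sum-cong-≋ (λ j → begin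
             conj (x i) * (gram u i j * x j)
               ≈⟨ *-congˡ (*-congʳ (gram-expand u i j)) ⟩
             conj (x i) * (sum (λ k → fromℚ (u i k) * fromℚ (u j k)) * x j)
               ≈⟨ *-congˡ (*-distribʳ-sum (x j) (λ k → fromℚ (u i k) * fromℚ (u j k))) ⟩
             conj (x i) * sum (λ k → fromℚ (u i k) * fromℚ (u j k) * x j)
               ≈⟨ *-distribˡ-sum (conj (x i)) (λ k → fromℚ (u i k) * fromℚ (u j k) * x j) ⟩
             sum (λ k → conj (x i) * (fromℚ (u i k) * fromℚ (u j k) * x j))
               ≈⟨ sum-cong-≋ (λ k → *-regroup (conj (x i)) (fromℚ (u i k)) (fromℚ (u j k)) (x j)) ⟩
             sum (λ k → (conj (x i) * fromℚ (u i k)) * (fromℚ (u j k) * x j)) ∎)) ⟩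
      sum (λ i → sum (λ j → sum (λ k → (conj (x i) * fromℚ (u i k)) * (fromℚ (u j k) * x j))))
        ≈⟨ sum-cong-≋ (λ i → ∑-comm (λ j k → (conj (x i) * fromℚ (u i k)) * (fromℚ (u j k) * x j))) ⟩
      sum (λ i → sum (λ k → sum (λ j → (conj (x i) * fromℚ (u i k)) * (fromℚ (u j k) * x j))))
        ≈⟨ ∑-comm (λ i k → sum (λ j → (conj (x i) * fromℚ (u i k)) * (fromℚ (u j k) * x j))) ⟩
      sum (λ k → sum (λ i → sum (λ j → (conj (x i) * fromℚ (u i k)) * (fromℚ (u j k) * x j))))
        ≈⟨ sum-cong-≋ (λ k → sum-cong-≋ (λ i → *-distribˡ-sum (conj (x i) * fromℚ (u i k)) (λ j → fromℚ (u j k) * x j))) ⟨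
      sum (λ k → sum (λ i → (conj (x i) * fromℚ (u i k)) * y x k))
        ≈⟨ sum-cong-≋ (λ k → *-distribʳ-sum (y x k) (λ i → conj (x i) * fromℚ (u i k))) ⟨
      sum (λ k → sum (λ i → conj (x i) * fromℚ (u i k)) * y x k)
        ≈⟨ sum-cong-≋ (λ k → *-congʳ (conj-y x k)) ⟨
      ⟨ y x , y x ⟩ ∎

  -- More than r vectors in ℚʳ satisfy a nontrivial rational relation, which every column entry
  -- inherits by linearity. The relation is found over ℚ and only then mapped into the scalars.
  gram-rank : ∀ {n r} (u : Fin n → Vector ℚ r) s (f : Fin s → Fin n) →
    LinearlyIndependent (column (gram u) ∘ f) → s ℕ.≤ r
  gram-rank {r = r} u s f independent with s ℕ.≤? r
  ... | yes s≤r = s≤r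
  ... | no s≰r =
    let c , (t , ct≢0) , ker = underdetermined r s (ℕ.≰⇒> s≰r) (λ k t → u (f t) k)
    in contradiction (fromℚ-injective₀ (c t) (independent (fromℚ ∘ c) (dependence c ker) t)) ct≢0
    where
    module _ (c : Vector ℚ s) (ker : ∀ k → sumℚ (λ t → u (f t) k ℚ.* c t) ≡ 0ℚ) where
      dependence : ∀ i → sum (λ t → fromℚ (c t) * gram u i (f t)) ≈ 0#
      dependence i = begin
        sum (λ t → fromℚ (c t) * gram u i (f t))
          ≈⟨ sum-cong-≋ (λ t → ≈-trans (*-congˡ (gram-expand u i (f t)))
               (*-distribˡ-sum (fromℚ (c t)) (λ k → fromℚ (u i k) * fromℚ (u (f t) k)))) ⟩
        sum (λ t → sum (λ k → fromℚ (c t) * (fromℚ (u i k) * fromℚ (u (f t) k))))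
          ≈⟨ ∑-comm (λ t k → fromℚ (c t) * (fromℚ (u i k) * fromℚ (u (f t) k))) ⟩
        sum (λ k → sum (λ t → fromℚ (c t) * (fromℚ (u i k) * fromℚ (u (f t) k))))
          ≈⟨ sum-zero _ (λ k → begin
               sum (λ t → fromℚ (c t) * (fromℚ (u i k) * fromℚ (u (f t) k)))
                 ≈⟨ sum-cong-≋ (λ t → *-rotate (fromℚ (c t)) (fromℚ (u i k)) (fromℚ (u (f t) k))) ⟩
               sum (λ t → fromℚ (u i k) * (fromℚ (u (f t) k) * fromℚ (c t)))
                 ≈⟨ *-distribˡ-sum (fromℚ (u i k)) (λ t → fromℚ (u (f t) k) * fromℚ (c t)) ⟨
               fromℚ (u i k) * sum (λ t → fromℚ (u (f t) k) * fromℚ (c t))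
                 ≈⟨ *-congˡ (≈-trans (fromℚ-sum (λ t → u (f t) k ℚ.* c t))
                      (sum-cong-≋ (λ t → fromℚ-* (u (f t) k) (c t)))) ⟨
               fromℚ (u i k) * fromℚ (sumℚ (λ t → u (f t) k ℚ.* c t))
                 ≈⟨ *-congˡ (≈-trans (fromℚ-cong (ker k)) fromℚ-0) ⟩
               fromℚ (u i k) * 0#
                 ≈⟨ zeroʳ (fromℚ (u i k)) ⟩
               0# ∎) ⟩
        0# ∎

  -- The columns at the forced vertices serve twice: they show that the Gram matrix attains rank r,
  -- and they bound the rank of every other matrix with graph G from below.
  isMinPSDRank : ∀ {n} {G : Graph n} {r} → GramRepresentation G r → ForcingComplement G r → IsMinPSDRank G r
  isMinPSDRank {n} {G} {r} rep F =
      (gram vector , gram-psd vector , gram-graph ,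
        (ForcingComplement.vertex F , forcing⇒independent (gram-psd vector) gram-graph F) , gram-rank vector)
    , λ B s B-psd B-graph (_ , maximal) →
        maximal r (ForcingComplement.vertex F) (forcing⇒independent B-psd B-graph F)
    where
    open GramRepresentation rep
    gram-graph : HasGraph (gram vector) G
    gram-graph i j = mk⇔
      (λ (i≢j , ij≉0) → decidable-stable (adj? G i j) λ ¬ij →
        ij≉0 (≈-trans (fromℚ-cong (nonadjacent i≢j ¬ij)) fromℚ-0))
      (λ ij → (λ i≡j → adj-irrefl G i≡j ij) , λ ij≈0 → adjacent ij (fromℚ-injective₀ _ ij≈0))

isMr₊ : ∀ {n} {G : Graph n} {r} → GramRepresentation G r → ForcingComplement G r → IsMr₊ G r
isMr₊ rep F = LinearAlgebra.isMinPSDRank ℝ-isInvolutiveDomain rep F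
            , LinearAlgebra.isMinPSDRank ℂ-isInvolutiveDomain rep F

-- Corona products

open import Data.Nat.Base using (_≤_; _+_; _*_; _∸_)

-- Together with `apex` the vectors represent the cone over G, that is G with a new vertex joined to
-- all others, still in dimension r.
record ConeRepresentation {n} (G : Graph n) (r : ℕ) : Set where
  field
    representation : GramRepresentation G r
  open GramRepresentation representation public
  field
    apex    : Vector ℚ r
    meets   : ∀ i → dot (vector i) apex ≢ 0ℚ

-- Orthogonal block vectors

dot-comm : ∀ {r} (x y : Vector ℚ r) → dot x y ≡ dot y x
dot-comm x y = ℚ-Sum.sum-cong-≗ λ k → ℚ.*-comm (x k) (y k)

dot-zeroˡ : ∀ {r} (y : Vector ℚ r) → dot (λ _ → 0ℚ) y ≡ 0ℚ
dot-zeroˡ {r} y = trans (ℚ-Sum.sum-cong-≗ λ k → ℚ.*-zeroˡ (y k)) (ℚ-Sum.sum-replicate-zero r)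

sum-split : ∀ a {b} (f : Vector ℚ (a + b)) → sumℚ f ≡ sumℚ (λ i → f (i ↑ˡ b)) ℚ.+ sumℚ (λ j → f (a ↑ʳ j))
sum-split zero    f = sym (ℚ.+-identityˡ (sumℚ f))
sum-split (suc a) f = trans (cong (f zero ℚ.+_) (sum-split a (f ∘ suc))) (sym (ℚ.+-assoc (f zero) _ _))

sum-combine : ∀ a {b} (f : Vector ℚ (a * b)) → sumℚ f ≡ sumℚ (λ i → sumℚ (λ j → f (combine {a} {b} i j)))
sum-combine zero    f = refl
sum-combine (suc a) {b} f = trans (sum-split b f)
  (cong (sumℚ (λ j → f (j ↑ˡ (a * b))) ℚ.+_) (sum-combine a (λ k → f (b ↑ʳ k))))

dot-++ : ∀ {a b} (x x′ : Vector ℚ a) (y y′ : Vector ℚ b) → dot (x ++ y) (x′ ++ y′) ≡ dot x x′ ℚ.+ dot y y′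
dot-++ {a} {b} x x′ y y′ = trans (sum-split a (λ k → (x ++ y) k ℚ.* (x′ ++ y′) k))
  (cong₂ ℚ._+_
    (ℚ-Sum.sum-cong-≗ λ i → cong₂ ℚ._*_ (lookup-++ˡ x y i) (lookup-++ˡ x′ y′ i))
    (ℚ-Sum.sum-cong-≗ λ j → cong₂ ℚ._*_ (lookup-++ʳ x y j) (lookup-++ʳ x′ y′ j)))

block : ∀ {n r} → Fin n → Vector ℚ r → Vector ℚ (n * r)
block {n} {r} i x k = let j , l = remQuot {n} r k in if does (i Fin.≟ j) then x l else 0ℚ

dot-block : ∀ {n r} (i j : Fin n) (x y : Vector ℚ r) →
  dot (block i x) (block j y) ≡ sumℚ λ l → if does (i Fin.≟ l) then (if does (j Fin.≟ l) then dot x y else 0ℚ) else 0ℚ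
dot-block {n} {r} i j x y = trans
  (sum-combine n (λ k → block i x k ℚ.* block j y k))
  (ℚ-Sum.sum-cong-≗ λ l → trans
    (ℚ-Sum.sum-cong-≗ λ t → cong₂ (λ p q → entry i x p ℚ.* entry j y q)
      (Fin.remQuot-combine {n} {r} l t) (Fin.remQuot-combine {n} {r} l t))
    (cases l))
  where
  entry : Fin n → Vector ℚ r → Fin n × Fin r → ℚ
  entry i x (l , t) = if does (i Fin.≟ l) then x t else 0ℚ

  cases : ∀ l → sumℚ (λ t → entry i x (l , t) ℚ.* entry j y (l , t)) ≡
    (if does (i Fin.≟ l) then (if does (j Fin.≟ l) then dot x y else 0ℚ) else 0ℚ)
  cases l with i Fin.≟ l | j Fin.≟ l
  ... | yes _ | yes _ = refl
  ... | yes _ | no _  = trans (dot-comm x (λ _ → 0ℚ)) (dot-zeroˡ x)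
  ... | no _  | q     = dot-zeroˡ (λ t → if does q then y t else 0ℚ)

sum-δ : ∀ {n} (i : Fin n) q → sumℚ (λ l → if does (i Fin.≟ l) then q else 0ℚ) ≡ q
sum-δ {suc n} zero    q = trans (cong (q ℚ.+_) (ℚ-Sum.sum-replicate-zero n)) (ℚ.+-identityʳ q)
sum-δ {suc n} (suc i) q = trans (ℚ.+-identityˡ _) (sum-δ i q)

dot-block-≡ : ∀ {n r} (i : Fin n) (x y : Vector ℚ r) → dot (block i x) (block i y) ≡ dot x y
dot-block-≡ {n} i x y = trans (dot-block i i x y) (trans (ℚ-Sum.sum-cong-≗ same) (sum-δ i (dot x y)))
  where
  same : ∀ l → (if does (i Fin.≟ l) then (if does (i Fin.≟ l) then dot x y else 0ℚ) else 0ℚ)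
    ≡ (if does (i Fin.≟ l) then dot x y else 0ℚ)
  same l with i Fin.≟ l
  ... | yes _ = refl
  ... | no _  = refl

dot-block-≢ : ∀ {n r} {i j : Fin n} → i ≢ j → (x y : Vector ℚ r) → dot (block i x) (block j y) ≡ 0ℚ
dot-block-≢ {n} {i = i} {j} i≢j x y =
  trans (dot-block i j x y) (trans (ℚ-Sum.sum-cong-≗ disjoint) (ℚ-Sum.sum-replicate-zero n))
  where
  disjoint : ∀ l → (if does (i Fin.≟ l) then (if does (j Fin.≟ l) then dot x y else 0ℚ) else 0ℚ) ≡ 0ℚ
  disjoint l with i Fin.≟ l | j Fin.≟ l
  ... | yes refl | yes refl = contradiction refl i≢j
  ... | yes _    | no _     = refl
  ... | no _     | _        = refl

-- Forcing and Gram vectors in the corona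

module Corona {n m} (G : Graph n) (H : Graph m) where

  coronaIndex : CoronaVertex n m → Fin (n * m + n)
  coronaIndex = join (n * m) n ∘ Sum.map₁ (uncurry combine)

  coronaVertex-index : ∀ x → coronaVertex n m (coronaIndex x) ≡ x
  coronaVertex-index (inj₁ (i , u)) = trans
    (cong (Sum.map₁ (remQuot {n} m)) (Fin.splitAt-↑ˡ (n * m) (combine i u) n))
    (cong inj₁ (Fin.remQuot-combine i u))
  coronaVertex-index (inj₂ i) = cong (Sum.map₁ (remQuot {n} m)) (Fin.splitAt-↑ʳ (n * m) n i)

  coronaIndex-vertex : ∀ v → coronaIndex (coronaVertex n m v) ≡ v
  coronaIndex-vertex v = trans
    (cong (join (n * m) n) (inverse (splitAt (n * m) v))) (Fin.join-splitAt (n * m) n v)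
    where
    inverse : ∀ x → Sum.map₁ (uncurry combine) (Sum.map₁ {B = Fin n} (remQuot {n} m) x) ≡ x
    inverse (inj₁ k) = cong inj₁ (Fin.combine-remQuot {n} m k)
    inverse (inj₂ i) = refl

  coronaVertex-injective : ∀ {v w} → coronaVertex n m v ≡ coronaVertex n m w → v ≡ w
  coronaVertex-injective {v} {w} e =
    trans (sym (coronaIndex-vertex v)) (trans (cong coronaIndex e) (coronaIndex-vertex w))

  module _ {Z : CoronaVertex n m → Set} {Z₁ : Fin n → Set} {Z₂ : Fin m → Set}
    (base : ∀ {i} → Z₁ i → Z (inj₂ i)) (copy : ∀ {i u} → Z₂ u → Z (inj₁ (i , u))) where

    private
      F : CoronaVertex n m → Set₁
      F = Forced (CoronaAdj G H) Z

    -- Vertex i is adjacent to the whole copy, hence on the boundary of every nonempty set inside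
    -- it. Since it is forced already, forcing runs in the copy as in H.
    forced-copy : ∀ {i u} → F (inj₂ i) → Forced (Adj H) Z₂ u → F (inj₁ (i , u))
    forced-copy Fi (initial z) = initial (copy z)
    forced-copy {i} Fi (force {u} {v} W v∈W uv Fu boundary neighbours) =
      force {u = inj₁ (i , u)} W′ (refl , v∈W) (refl , uv) (forced-copy Fi Fu) boundary′ neighbours′
      where
      W′ : CoronaVertex n m → Set
      W′ (inj₁ (j , w)) = j ≡ i × W w
      W′ (inj₂ _)       = ⊥
      boundary′ : ∀ {x y} → W′ x → ¬ W′ y → CoronaAdj G H x y → F y
      boundary′ {inj₁ _} {inj₁ _} (refl , a∈W) b∉W (refl , ab) =
        forced-copy Fi (boundary a∈W (λ b∈W → b∉W (refl , b∈W)) ab)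
      boundary′ {inj₁ _} {inj₂ _} (refl , _) _ refl = Fi
      neighbours′ : ∀ {y} → W′ y → CoronaAdj G H (inj₁ (i , u)) y → y ≢ inj₁ (i , v) → F y
      neighbours′ {inj₁ _} (refl , b∈W) (_ , ub) y≢v =
        forced-copy Fi (neighbours b∈W ub λ b≡v → y≢v (cong (λ w → inj₁ (i , w)) b≡v))

    -- Adding to W the copies over W leaves only edges of G on the boundary. If u itself lies in W,
    -- its further neighbours are the vertices of its own copy, which `forced-copy` forces because
    -- vertex u is forced.
    forced-base : (∀ u → Forced (Adj H) Z₂ u) → ∀ {i} → Forced (Adj G) Z₁ i → F (inj₂ i)
    forced-base all (initial z) = initial (base z)
    forced-base all (force {u} {v} W v∈W uv Fu boundary neighbours) =
      force {u = inj₂ u} W′ v∈W uv (forced-base all Fu)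
        (λ {x} {y} → boundary′ {x} {y}) (λ {y} → neighbours′ {y})
      where
      W′ : CoronaVertex n m → Set
      W′ (inj₁ (j , _)) = W j
      W′ (inj₂ j)       = W j
      boundary′ : ∀ {x y} → W′ x → ¬ W′ y → CoronaAdj G H x y → F y
      boundary′ {inj₁ _} {inj₁ _} x∈W y∉W (refl , _) = contradiction x∈W y∉W
      boundary′ {inj₁ _} {inj₂ _} x∈W y∉W refl       = contradiction x∈W y∉W
      boundary′ {inj₂ _} {inj₁ _} x∈W y∉W refl       = contradiction x∈W y∉W
      boundary′ {inj₂ _} {inj₂ _} x∈W y∉W xy         = forced-base all (boundary x∈W y∉W xy)
      neighbours′ : ∀ {y} → W′ y → CoronaAdj G H (inj₂ u) y → y ≢ inj₂ v → F y
      neighbours′ {inj₁ (_ , w)} _ refl _ = forced-copy (forced-base all Fu) (all w)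
      neighbours′ {inj₂ j} j∈W uj y≢v =
        forced-base all (neighbours j∈W uj λ j≡v → y≢v (cong inj₂ j≡v))

  -- Transport along the bijection between indices and corona vertices. The vertex x is tied to v by
  -- an equation, so that the recursion can follow the forcing derivation for arbitrary x.
  forced-index : ∀ {Z x} → Forced (CoronaAdj G H) Z x → ∀ {v} → coronaVertex n m v ≡ x →
    Forced (Adj (G ∘ᶜ H)) (Z ∘ coronaVertex n m) v
  forced-index {Z} (initial z) e = initial (subst Z (sym e) z)
  forced-index (force {u} {x} W x∈W ux Fu boundary neighbours) {v} refl =
    force {u = coronaIndex u} (W ∘ coronaVertex n m) x∈W
      (subst (λ y → CoronaAdj G H y x) (sym (coronaVertex-index u)) ux)
      (forced-index Fu (coronaVertex-index u))
      (λ i∈W j∉W ij → forced-index (boundary i∈W j∉W ij) refl)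
      (λ {j} j∈W uj j≢v → forced-index
        (neighbours j∈W (subst (λ y → CoronaAdj G H y (coronaVertex n m j)) (coronaVertex-index u) uj)
          (λ e → j≢v (coronaVertex-injective e))) refl)

  forcingComplement : ∀ {r s} → ForcingComplement G r → ForcingComplement H s →
    ForcingComplement (G ∘ᶜ H) (r + n * s)
  forcingComplement {r} {s} F₁ F₂ = record
    { vertex    = coronaIndex ∘ select
    ; injective = λ {k} {l} e → select-injective k l
        (trans (sym (coronaVertex-index (select k))) (trans (cong (coronaVertex n m) e) (coronaVertex-index (select l))))
    ; forced    = λ v → weaken (forced-index (forced-all (coronaVertex n m v)) refl)
    }
    where
    open module F₁ = ForcingComplement F₁ using () renaming (vertex to f₁)
    open module F₂ = ForcingComplement F₂ using () renaming (vertex to f₂)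

    place : Fin r ⊎ Fin (n * s) → CoronaVertex n m
    place (inj₁ a) = inj₂ (f₁ a)
    place (inj₂ b) = let i , c = remQuot {n} s b in inj₁ (i , f₂ c)

    select : Fin (r + n * s) → CoronaVertex n m
    select k = place (splitAt r k)

    place-injective : ∀ x y → place x ≡ place y → x ≡ y
    place-injective (inj₁ a) (inj₁ b) e = cong inj₁ (F₁.injective (inj₂-injective e))
    place-injective (inj₂ a) (inj₂ b) e = cong inj₂ (trans (sym (Fin.combine-remQuot {n} s a))
      (trans (cong₂ combine (cong proj₁ (inj₁-injective e)) (F₂.injective (cong proj₂ (inj₁-injective e))))
        (Fin.combine-remQuot {n} s b)))

    select-injective : ∀ k l → select k ≡ select l → k ≡ l
    select-injective k l e = trans (sym (Fin.join-splitAt r (n * s) k))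
      (trans (cong (join r (n * s)) (place-injective (splitAt r k) (splitAt r l) e)) (Fin.join-splitAt r (n * s) l))

    Z : CoronaVertex n m → Set
    Z x = ∀ k → place k ≢ x

    base : ∀ {i} → (∀ a → f₁ a ≢ i) → Z (inj₂ i)
    base i∉f₁ (inj₁ a) e = i∉f₁ a (inj₂-injective e)

    copy : ∀ {i u} → (∀ c → f₂ c ≢ u) → Z (inj₁ (i , u))
    copy u∉f₂ (inj₂ b) e = u∉f₂ (proj₂ (remQuot {n} s b)) (cong proj₂ (inj₁-injective e))

    forced-all : ∀ x → Forced (CoronaAdj G H) Z x
    forced-all (inj₁ (i , u)) = forced-copy base copy (forced-all (inj₂ i)) (F₂.forced u)
    forced-all (inj₂ i)       = forced-base base copy F₂.forced (F₁.forced i)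

    weaken : ∀ {v} → Forced (Adj (G ∘ᶜ H)) (Z ∘ coronaVertex n m) v →
      Forced (Adj (G ∘ᶜ H)) (λ w → ∀ k → coronaIndex (select k) ≢ w) v
    weaken (initial z) = initial λ k e → z (splitAt r k)
      (trans (sym (coronaVertex-index (select k))) (cong (coronaVertex n m) e))
    weaken (force W v∈W uv Fu boundary neighbours) = force W v∈W uv (weaken Fu)
      (λ i∈W j∉W ij → weaken (boundary i∈W j∉W ij)) (λ j∈W uj j≢v → weaken (neighbours j∈W uj j≢v))

  -- The apex components of distinct vertices of G lie in different blocks, so they alter only the
  -- diagonal of the Gram matrix of `R₁`, which is unconstrained. A copy vanishes on the first r
  -- coordinates and thus sees of the base vertices only their apex components.
  gramRepresentation : ∀ {r s} → GramRepresentation G r → ConeRepresentation H s →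
    GramRepresentation (G ∘ᶜ H) (r + n * s)
  gramRepresentation {r} {s} R₁ R₂ = record
    { vector      = vec ∘ coronaVertex n m
    ; adjacent    = λ {v} {w} → adjacent (coronaVertex n m v) (coronaVertex n m w)
    ; nonadjacent = λ {v} {w} v≢w → nonadjacent (coronaVertex n m v) (coronaVertex n m w)
        (λ e → v≢w (coronaVertex-injective e))
    }
    where
    module R₁ = GramRepresentation R₁
    module R₂ = ConeRepresentation R₂

    zeros : Vector ℚ r
    zeros _ = 0ℚ

    vec : CoronaVertex n m → Vector ℚ (r + n * s)
    vec (inj₁ (i , u)) = zeros ++ block i (R₂.vector u)
    vec (inj₂ i)       = R₁.vector i ++ block i R₂.apex

    dot-zeros : ∀ (x : Vector ℚ r) (y z : Vector ℚ (n * s)) → dot (zeros ++ y) (x ++ z) ≡ dot y z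
    dot-zeros x y z = trans (dot-++ zeros x y z)
      (trans (cong (ℚ._+ dot y z) (dot-zeroˡ x)) (ℚ.+-identityˡ (dot y z)))

    dot-bases : ∀ {i j} → i ≢ j → dot (vec (inj₂ i)) (vec (inj₂ j)) ≡ dot (R₁.vector i) (R₁.vector j)
    dot-bases {i} {j} i≢j = trans (dot-++ (R₁.vector i) (R₁.vector j) (block i R₂.apex) (block j R₂.apex))
      (trans (cong (dot (R₁.vector i) (R₁.vector j) ℚ.+_) (dot-block-≢ i≢j R₂.apex R₂.apex)) (ℚ.+-identityʳ _))

    dot-copies : ∀ {i u j v} → dot (vec (inj₁ (i , u))) (vec (inj₁ (j , v))) ≡ dot (block i (R₂.vector u)) (block j (R₂.vector v))
    dot-copies {i} {u} {j} {v} = dot-zeros zeros (block i (R₂.vector u)) (block j (R₂.vector v))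

    dot-copy-base : ∀ {i u j} → dot (vec (inj₁ (i , u))) (vec (inj₂ j)) ≡ dot (block i (R₂.vector u)) (block j R₂.apex)
    dot-copy-base {i} {u} {j} = dot-zeros (R₁.vector j) (block i (R₂.vector u)) (block j R₂.apex)

    adjacent : ∀ x y → CoronaAdj G H x y → dot (vec x) (vec y) ≢ 0ℚ
    adjacent (inj₁ (i , u)) (inj₁ (_ , v)) (refl , uv) = subst (_≢ 0ℚ)
      (sym (trans (dot-copies {i} {u} {i} {v}) (dot-block-≡ i (R₂.vector u) (R₂.vector v)))) (R₂.adjacent uv)
    adjacent (inj₁ (i , u)) (inj₂ _) refl = subst (_≢ 0ℚ)
      (sym (trans (dot-copy-base {i} {u} {i}) (dot-block-≡ i (R₂.vector u) R₂.apex))) (R₂.meets u)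
    adjacent (inj₂ i) (inj₁ (_ , u)) refl = subst (_≢ 0ℚ)
      (dot-comm (vec (inj₁ (i , u))) (vec (inj₂ i))) (adjacent (inj₁ (i , u)) (inj₂ i) refl)
    adjacent (inj₂ i) (inj₂ j) ij = subst (_≢ 0ℚ)
      (sym (dot-bases λ i≡j → adj-irrefl G i≡j ij)) (R₁.adjacent ij)

    nonadjacent : ∀ x y → x ≢ y → ¬ CoronaAdj G H x y → dot (vec x) (vec y) ≡ 0ℚ
    nonadjacent (inj₁ (i , u)) (inj₁ (j , v)) x≢y ¬xy with i Fin.≟ j
    ... | yes refl = trans (dot-copies {i} {u} {i} {v}) (trans (dot-block-≡ i (R₂.vector u) (R₂.vector v))
      (R₂.nonadjacent (λ u≡v → x≢y (cong (λ w → inj₁ (i , w)) u≡v)) (λ uv → ¬xy (refl , uv))))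
    ... | no i≢j = trans (dot-copies {i} {u} {j} {v}) (dot-block-≢ i≢j (R₂.vector u) (R₂.vector v))
    nonadjacent (inj₁ (i , u)) (inj₂ j) x≢y ¬xy =
      trans (dot-copy-base {i} {u} {j}) (dot-block-≢ ¬xy (R₂.vector u) R₂.apex)
    nonadjacent (inj₂ i) (inj₁ (j , u)) x≢y ¬xy =
      trans (dot-comm (vec (inj₂ i)) (vec (inj₁ (j , u))))
        (trans (dot-copy-base {j} {u} {i}) (dot-block-≢ (λ j≡i → ¬xy (sym j≡i)) (R₂.vector u) R₂.apex))
    nonadjacent (inj₂ i) (inj₂ j) x≢y ¬xy =
      trans (dot-bases i≢j) (R₁.nonadjacent i≢j ¬xy)
      where
      i≢j : i ≢ j
      i≢j i≡j = x≢y (cong inj₂ i≡j)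

-- Trees, complete graphs and cycles

open import Relation.Binary.Construct.Closure.ReflexiveTransitive using (Star; ε; _◅_; _◅◅_; reverse)

-- Incidence vectors of clique covers

indicator : ∀ {P : Set} → Dec P → ℚ
indicator P? = if does P? then 1ℚ else 0ℚ

indicator-yes : ∀ {P : Set} (P? : Dec P) → P → indicator P? ≡ 1ℚ
indicator-yes (yes _) _ = refl
indicator-yes (no ¬p) p = contradiction p ¬p

indicator-no : ∀ {P : Set} (P? : Dec P) → ¬ P → indicator P? ≡ 0ℚ
indicator-no (yes p) ¬p = contradiction p ¬p
indicator-no (no _)  _  = refl

indicator≥0 : ∀ {P : Set} (P? : Dec P) → 0ℚ ℚ.≤ indicator P?
indicator≥0 (yes _) = ℚ.nonNegative⁻¹ 1ℚ
indicator≥0 (no _)  = ℚ.≤-refl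

sum≥0 : ∀ {r} (f : Vector ℚ r) → (∀ k → 0ℚ ℚ.≤ f k) → 0ℚ ℚ.≤ sumℚ f
sum≥0 {zero}  f f≥0 = ℚ.≤-refl
sum≥0 {suc r} f f≥0 = ℚ.+-mono-≤ (f≥0 zero) (sum≥0 (f ∘ suc) (f≥0 ∘ suc))

sum>0 : ∀ {r} (f : Vector ℚ r) → (∀ k → 0ℚ ℚ.≤ f k) → ∀ k → 0ℚ ℚ.< f k → 0ℚ ℚ.< sumℚ f
sum>0 f f≥0 zero    f>0 = ℚ.+-mono-<-≤ f>0 (sum≥0 (f ∘ suc) (f≥0 ∘ suc))
sum>0 f f≥0 (suc k) f>0 = ℚ.+-mono-≤-< (f≥0 zero) (sum>0 (f ∘ suc) (f≥0 ∘ suc) k f>0)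

sum-neg : ∀ {r} (f : Vector ℚ r) → sumℚ (λ k → ℚ.- f k) ≡ ℚ.- sumℚ f
sum-neg {zero}  f = refl
sum-neg {suc r} f = trans (cong (ℚ.- f zero ℚ.+_) (sum-neg (f ∘ suc))) (sym (ℚ.neg-distrib-+ (f zero) (sumℚ (f ∘ suc))))

dot≢0 : ∀ {r} (x y : Vector ℚ r) → (∀ k → 0ℚ ℚ.≤ x k) → (∀ k → 0ℚ ℚ.≤ y k) →
  ∀ k → 0ℚ ℚ.< x k → 0ℚ ℚ.< y k → dot x y ≢ 0ℚ
dot≢0 x y x≥0 y≥0 k xk>0 yk>0 dot≡0 = ℚ.<-irrefl (sym dot≡0)
  (sum>0 (λ l → x l ℚ.* y l)
    (λ l → ℚ.nonNegative⁻¹ _ {{ℚ.nonNeg*nonNeg⇒nonNeg (x l) {{ℚ.nonNegative (x≥0 l)}} (y l) {{ℚ.nonNegative (y≥0 l)}}}})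
    k (ℚ.positive⁻¹ _ {{ℚ.pos*pos⇒pos (x k) {{ℚ.positive xk>0}} (y k) {{ℚ.positive yk>0}}}}))

module Incidence {n r} {I : Fin n → Fin r → Set} (I? : ∀ i k → Dec (I i k)) where

  incidence : Fin n → Vector ℚ r
  incidence i k = indicator (I? i k)

  incidence≥0 : ∀ i k → 0ℚ ℚ.≤ incidence i k
  incidence≥0 i k = indicator≥0 (I? i k)

  incidence>0 : ∀ {i k} → I i k → 0ℚ ℚ.< incidence i k
  incidence>0 {i} {k} ik = subst (0ℚ ℚ.<_) (sym (indicator-yes (I? i k) ik)) (ℚ.positive⁻¹ 1ℚ)

  incident-dot : ∀ {i j k} → I i k → I j k → dot (incidence i) (incidence j) ≢ 0ℚ
  incident-dot {i} {j} {k} ik jk =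
    dot≢0 (incidence i) (incidence j) (incidence≥0 i) (incidence≥0 j) k (incidence>0 ik) (incidence>0 jk)

  nonincident-dot : ∀ {i j} → (∀ k → I i k → ¬ I j k) → dot (incidence i) (incidence j) ≡ 0ℚ
  nonincident-dot {i} {j} disjoint = trans (ℚ-Sum.sum-cong-≗ term) (ℚ-Sum.sum-replicate-zero r)
    where
    term : ∀ k → incidence i k ℚ.* incidence j k ≡ 0ℚ
    term k with I? i k
    ... | no _   = ℚ.*-zeroˡ (incidence j k)
    ... | yes ik = cong (1ℚ ℚ.*_) (indicator-no (I? j k) (disjoint k ik))

  -- The hypotheses say that I covers the edges of G by r cliques and that every vertex lies in one
  -- of them. Entries 0 and 1 admit no cancellation, so a product vanishes exactly when no clique is
  -- shared, and the all-ones vector meets every vertex. A complete graph is a single clique; in a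
  -- tree the cliques are the edges.
  coneRepresentation : (G : Graph n) →
    (∀ {i j} → Adj G i j → ∃[ k ] (I i k × I j k)) →
    (∀ {i j} k → i ≢ j → I i k → I j k → Adj G i j) →
    (∀ i → ∃[ k ] I i k) → ConeRepresentation G r
  coneRepresentation G edge common incident = record
    { representation = record
      { vector      = incidence
      ; adjacent    = λ ij → let k , ik , jk = edge ij in incident-dot ik jk
      ; nonadjacent = λ {i} {j} i≢j ¬ij → nonincident-dot {i} {j} λ k ik jk → ¬ij (common k i≢j ik jk)
      }
    ; apex  = λ _ → 1ℚ
    ; meets = λ i → let k , ik = incident i in
        dot≢0 (incidence i) (λ _ → 1ℚ) (incidence≥0 i) (λ _ → ℚ.nonNegative⁻¹ 1ℚ) k (incidence>0 ik) (ℚ.positive⁻¹ 1ℚ)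
    }

module Complete (n : ℕ) where

  forcingComplement : ForcingComplement (complete (2 + n)) 1
  forcingComplement = record
    { vertex    = λ _ → zero
    ; injective = λ { {zero} {zero} _ → refl }
    ; forced    = λ
      -- All vertices but 0 are initial, so W = {0} has a forced boundary; order at least 2 supplies
      -- the forcing neighbour 1.
      { zero    → force {u = suc zero} (_≡ zero) refl (λ ()) (initial λ _ ())
          (λ { {j = zero} _ j≢0 _ → contradiction refl j≢0 ; {j = suc _} _ _ _ → initial λ _ () })
          (λ j≡0 _ j≢0 → contradiction j≡0 j≢0)
      ; (suc v) → initial λ _ ()
      }
    }

  coneRepresentation : ConeRepresentation (complete (2 + n)) 1
  coneRepresentation = Incidence.coneRepresentation {I = λ _ _ → ⊤} (λ _ _ → yes tt) (complete (2 + n))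
    (λ _ → zero , tt , tt) (λ _ i≢j _ _ → i≢j) (λ _ → zero , tt)

-- Walks and paths avoiding a vertex

module _ {n} (G : Graph n) where

  AvoidingStep : Fin n → Rel (Fin n) 0ℓ
  AvoidingStep w a b = Adj G a b × a ≢ w × b ≢ w

  -- The empty walk imposes no condition and may sit at w itself, which is why `a ≢ w` is carried
  -- separately where it matters.
  AvoidingWalk : Fin n → Rel (Fin n) 0ℓ
  AvoidingWalk w = Star (AvoidingStep w)

  reverseWalk : ∀ {w a b} → AvoidingWalk w a b → AvoidingWalk w b a
  reverseWalk = reverse λ (ab , a≢w , b≢w) → adj-sym G ab , b≢w , a≢w

  record IsPath (w a b : Fin n) {k : ℕ} (p : Fin (suc k) → Fin n) : Set where
    field
      start     : p zero ≡ a
      end       : p (fromℕ k) ≡ b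
      injective : Injective _≡_ _≡_ p
      steps     : ∀ i j → toℕ j ≡ suc (toℕ i) → Adj G (p i) (p j)
      avoids    : ∀ i → p i ≢ w

  tailPath : ∀ {w a b k} {p : Fin (suc (suc k)) → Fin n} → IsPath w a b p → IsPath w (p (suc zero)) b (p ∘ suc)
  tailPath P = record
    { start     = refl
    ; end       = end
    ; injective = λ e → Fin.suc-injective (injective e)
    ; steps     = λ i j e → steps (suc i) (suc j) (cong suc e)
    ; avoids    = avoids ∘ suc
    }
    where open IsPath P

  suffixPath : ∀ {w a b k} {p : Fin (suc k) → Fin n} → IsPath w a b p → ∀ i →
    ∃[ l ] Σ[ q ∈ (Fin (suc l) → Fin n) ] IsPath w (p i) b q
  suffixPath {k = k} {p} P zero = k , p , record
    { start = refl ; end = end ; injective = injective ; steps = steps ; avoids = avoids }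
    where open IsPath P
  suffixPath {k = suc k} P (suc i) = suffixPath (tailPath P) i

  -- Loop erasure from the end of the walk: if the new first vertex already lies on the path
  -- obtained so far, the path is cut down to its suffix from there.
  walk⇒path : ∀ {w a b} → a ≢ w → AvoidingWalk w a b → ∃[ k ] Σ[ p ∈ (Fin (suc k) → Fin n) ] IsPath w a b p
  walk⇒path {a = a} a≢w ε = 0 , (λ _ → a) , record
    { start = refl ; end = refl ; injective = λ { {zero} {zero} _ → refl }
    ; steps = λ { zero zero () } ; avoids = λ _ → a≢w }
  walk⇒path {w} {a} {b} a≢w (_◅_ {j = c} (ac , _ , c≢w) walk) with walk⇒path c≢w walk
  ... | k , p , P with Fin.any? (λ i → p i Fin.≟ a)
  ...   | yes (i , refl) = suffixPath P i
  ...   | no a∉p = suc k , (a ∷ p) , record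
    { start     = refl
    ; end       = end
    ; injective = ∷-injective
    ; steps     = ∷-steps
    ; avoids    = λ { zero → a≢w ; (suc i) → avoids i }
    }
    where
    open IsPath P
    ∷-injective : Injective _≡_ _≡_ (a ∷ p)
    ∷-injective {zero}  {zero}  _ = refl
    ∷-injective {zero}  {suc j} e = contradiction (j , sym e) a∉p
    ∷-injective {suc i} {zero}  e = contradiction (i , e) a∉p
    ∷-injective {suc i} {suc j} e = cong suc (injective e)
    ∷-steps : ∀ i j → toℕ j ≡ suc (toℕ i) → Adj G ((a ∷ p) i) ((a ∷ p) j)
    ∷-steps zero    (suc zero) _ = subst (Adj G a) (sym start) ac
    ∷-steps (suc i) (suc j)    e = steps i j (ℕ.suc-injective e)

  -- If a and b differ, a path from a to b avoiding w closes up through w to a cycle. Such a path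
  -- has at least two vertices, so the cycle has length at least 3.
  acyclic-neighbours : Acyclic G → ∀ {w a b} → Adj G w a → Adj G w b → AvoidingWalk w a b → a ≡ b
  acyclic-neighbours acyclic {w} {a} {b} wa wb walk
    with walk⇒path (λ a≡w → adj-irrefl G (sym a≡w) wa) walk
  ... | zero  , p , P = trans (sym (IsPath.start P)) (IsPath.end P)
  ... | suc k , p , P = contradiction closed (acyclic (3 + k) (s≤s (s≤s (s≤s z≤n))) (w ∷ p) ∷-injective)
    where
    open IsPath P
    ∷-injective : Injective _≡_ _≡_ (w ∷ p)
    ∷-injective {zero}  {zero}  _ = refl
    ∷-injective {zero}  {suc j} e = contradiction (sym e) (avoids j)
    ∷-injective {suc i} {zero}  e = contradiction e (avoids i)
    ∷-injective {suc i} {suc j} e = cong suc (injective e)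
    closed : ∀ i j → CyclicSuc i j → Adj G ((w ∷ p) i) ((w ∷ p) j)
    closed zero    (suc zero) (inj₁ _)       = subst (Adj G w) (sym start) wa
    closed (suc i) (suc j)    (inj₁ e)       = steps i j (ℕ.suc-injective e)
    closed zero    zero       (inj₂ (() , _))
    closed (suc i) zero       (inj₂ (e , _)) = subst (λ x → Adj G x w)
      (sym (trans (cong p (Fin.toℕ-injective (trans (ℕ.suc-injective (ℕ.suc-injective e)) (sym (Fin.toℕ-fromℕ (suc k)))))) end))
      (adj-sym G wb)

  -- The tail is treated before the first step, so the exit found is the one after the last visit to
  -- v.
  last-exit : ∀ {v a z} → v ≢ z → Star (Adj G) a z →
    (a ≢ v × AvoidingWalk v a z) ⊎ (∃[ p ] (Adj G v p × AvoidingWalk v p z))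
  last-exit v≢z ε = inj₁ ((λ z≡v → v≢z (sym z≡v)) , ε)
  last-exit {v} {a} v≢z (ac ◅ walk) with last-exit v≢z walk | a Fin.≟ v
  ... | inj₂ exit          | _        = inj₂ exit
  ... | inj₁ (_ , walk′)   | yes refl = inj₂ (_ , ac , walk′)
  ... | inj₁ (c≢v , walk′) | no a≢v   = inj₁ (a≢v , (ac , a≢v , c≢v) ◅ walk′)

  exit : Connected G → ∀ {v z} → v ≢ z → ∃[ p ] (Adj G v p × AvoidingWalk v p z)
  exit connected {v} {z} v≢z with last-exit v≢z (connected v z)
  ... | inj₁ (v≢v , _) = contradiction refl v≢v
  ... | inj₂ e         = e

  visit-or-avoid : ∀ {v p z} u → AvoidingWalk v p z → AvoidingWalk v p u ⊎ (p ≢ u × AvoidingWalk u p z)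
  visit-or-avoid {p = p} u walk with p Fin.≟ u
  visit-or-avoid u walk | yes refl = inj₁ ε
  visit-or-avoid u ε | no p≢u = inj₂ (p≢u , ε)
  visit-or-avoid u (step ◅ walk) | no p≢u with visit-or-avoid u walk
  ... | inj₁ walk′         = inj₁ (step ◅ walk′)
  ... | inj₂ (q≢u , walk′) = inj₂ (p≢u , (proj₁ step , p≢u , q≢u) ◅ walk′)

-- Certificates of trees

module Tree {k} (T : Graph (suc k)) (T-tree : IsTree T) where

  private
    connected : Connected T
    connected = proj₁ T-tree
    acyclic : Acyclic T
    acyclic = proj₂ T-tree

  -- The tree is rooted at vertex 0, and the parent is a neighbour from which the root can be
  -- reached without passing through the child. The k other vertices thereby index the edges.
  parent : Fin k → Fin (suc k)
  parent j = proj₁ (exit T connected {suc j} {zero} (λ ()))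

  parent-adj : ∀ j → Adj T (suc j) (parent j)
  parent-adj j = proj₁ (proj₂ (exit T connected {suc j} {zero} (λ ())))

  parent-walk : ∀ j → AvoidingWalk T (suc j) (parent j) zero
  parent-walk j = proj₂ (proj₂ (exit T connected {suc j} {zero} (λ ())))

  -- For an edge between nonroot vertices, follow the walk from the parent of v to the root. If it
  -- meets u, then u and this parent are neighbours of v connected away from v, hence equal. If it
  -- avoids u, then v is connected away from u to the root and on to the parent of u, so v is that
  -- parent.
  edge-to-parent : ∀ u v → Adj T u v →
    (∃[ j ] (u ≡ suc j × parent j ≡ v)) ⊎ (∃[ j ] (v ≡ suc j × parent j ≡ u))
  edge-to-parent zero zero uv = contradiction uv (adj-irrefl T refl)
  edge-to-parent zero (suc j) uv =
    inj₂ (j , refl , acyclic-neighbours T acyclic (parent-adj j) (adj-sym T uv) (parent-walk j))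
  edge-to-parent (suc i) zero uv =
    inj₁ (i , refl , acyclic-neighbours T acyclic (parent-adj i) uv (parent-walk i))
  edge-to-parent (suc i) (suc j) uv with visit-or-avoid T (suc i) (parent-walk j)
  ... | inj₁ walk = inj₂ (j , refl , acyclic-neighbours T acyclic (parent-adj j) (adj-sym T uv) walk)
  ... | inj₂ (p≢i , walk) = inj₁ (i , refl , acyclic-neighbours T acyclic (parent-adj i) uv
    (parent-walk i ◅◅ (reverseWalk T walk ◅◅ ((adj-sym T (parent-adj j) , p≢i , j≢i) ◅ ε))))
    where
    j≢i : suc j ≢ suc i
    j≢i j≡i = adj-irrefl T (sym j≡i) uv

  -- The root alone is initial, and a forced vertex u forces any neighbour v. W is the branch at u
  -- containing v: its only outside neighbour is u, and by acyclicity v is the only neighbour of u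
  -- in it.
  forcingComplement : ForcingComplement T k
  forcingComplement = record
    { vertex    = suc
    ; injective = Fin.suc-injective
    ; forced    = λ v → spread (initial λ _ ()) (connected zero v)
    }
    where
    F : Fin (suc k) → Set₁
    F = Forced (Adj T) (λ w → ∀ j → suc j ≢ w)

    spread : ∀ {u v} → F u → Star (Adj T) u v → F v
    spread Fu ε = Fu
    spread {u} Fu (_◅_ {j = v} uv walk) = spread
      (force W ((λ v≡u → adj-irrefl T (sym v≡u) uv) , ε) uv Fu boundary
        (λ (_ , walk) uj j≢v → contradiction (sym (acyclic-neighbours T acyclic uv uj walk)) j≢v))
      walk
      where
      W : Fin (suc k) → Set
      W i = i ≢ u × AvoidingWalk T u v i
      boundary : ∀ {i j} → W i → ¬ W j → Adj T i j → F j
      boundary {i} {j} (i≢u , walk) j∉W ij with j Fin.≟ u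
      ... | yes refl = Fu
      ... | no j≢u   = contradiction (j≢u , walk ◅◅ ((ij , i≢u , j≢u) ◅ ε)) j∉W

  coneRepresentation : 1 ≤ k → ConeRepresentation T k
  coneRepresentation 1≤k = Incidence.coneRepresentation
    {I = λ v j → v ≡ suc j ⊎ v ≡ parent j} (λ v j → (v Fin.≟ suc j) ⊎-dec (v Fin.≟ parent j)) T
    edge common incident
    where
    edge : ∀ {u v} → Adj T u v → ∃[ j ] ((u ≡ suc j ⊎ u ≡ parent j) × (v ≡ suc j ⊎ v ≡ parent j))
    edge {u} {v} uv with edge-to-parent u v uv
    ... | inj₁ (j , e , f) = j , inj₁ e , inj₂ (sym f)
    ... | inj₂ (j , e , f) = j , inj₂ (sym f) , inj₁ e
    common : ∀ {u v} j → u ≢ v → u ≡ suc j ⊎ u ≡ parent j → v ≡ suc j ⊎ v ≡ parent j → Adj T u v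
    common j u≢v (inj₁ refl) (inj₁ refl) = contradiction refl u≢v
    common j u≢v (inj₁ refl) (inj₂ refl) = parent-adj j
    common j u≢v (inj₂ refl) (inj₁ refl) = adj-sym T (parent-adj j)
    common j u≢v (inj₂ refl) (inj₂ refl) = contradiction refl u≢v
    incident : ∀ v → ∃[ j ] (v ≡ suc j ⊎ v ≡ parent j)
    incident (suc j) = j , inj₁ refl
    -- The root is not of the form `suc j`; its edge is the first one on the way to vertex 1, which
    -- exists since k is at least 1.
    incident zero with exit T connected {zero} {Fin.suc (Fin.fromℕ< 1≤k)} (λ ())
    ... | v , 0v , _ with edge {zero} {v} 0v
    ...   | j , I0 , _ = j , I0

-- Alternating vectors and certificates of cycles

alternating : ∀ {k} → Vector ℚ k
alternating zero    = 1ℚ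
alternating (suc a) = ℚ.- alternating a

sum-alternating : ∀ k → sumℚ (alternating {k}) ≡ 0ℚ ⊎ sumℚ (alternating {k}) ≡ 1ℚ
sum-alternating zero = inj₁ refl
sum-alternating (suc k) = Sum.swap (Sum.map step step (sum-alternating k))
  where
  step : ∀ {q} → sumℚ (alternating {k}) ≡ q → sumℚ (alternating {suc k}) ≡ 1ℚ ℚ.- q
  step e = cong (1ℚ ℚ.+_) (trans (sum-neg (alternating {k})) (cong ℚ.-_ e))

module Path where

  Incident : ∀ {k} → Fin (suc k) → Fin k → Set
  Incident i a = i ≡ inject₁ a ⊎ i ≡ suc a

  incident? : ∀ {k} (i : Fin (suc k)) (a : Fin k) → Dec (Incident i a)
  incident? i a = (i Fin.≟ inject₁ a) ⊎-dec (i Fin.≟ suc a)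

  open module PathIncidence {k} = Incidence (incident? {k}) public
    using (incidence; incidence≥0; incidence>0; incident-dot; nonincident-dot)

  alternating-zero : ∀ k → dot alternating (incidence {suc k} zero) ≡ 1ℚ
  alternating-zero k = cong (1ℚ ℚ.+_) (trans
    (ℚ-Sum.sum-cong-≗ {k} λ a → ℚ.*-zeroʳ (ℚ.- alternating a)) (ℚ-Sum.sum-replicate-zero k))

  -- Deleting the first edge turns vertex `suc i` into vertex `i` of a shorter path and reverses all
  -- signs.
  alternating-suc : ∀ {k} (i : Fin (suc k)) →
    dot alternating (incidence {suc k} (suc i)) ≡ incidence {suc k} (suc i) zero ℚ.- dot alternating (incidence {k} i)
  alternating-suc {k} i = cong₂ ℚ._+_ (ℚ.*-identityˡ (incidence {suc k} (suc i) zero)) (trans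
    (ℚ-Sum.sum-cong-≗ {k} λ a → sym (ℚ.neg-distribˡ-* (alternating a) (incidence i a)))
    (sum-neg λ (a : Fin k) → alternating a ℚ.* incidence i a))

  -- An inner vertex lies on two consecutive edges, whose signs cancel.
  alternating-interior : ∀ {k} (i : Fin (suc k)) → i ≢ fromℕ k → dot alternating (incidence {suc k} (suc i)) ≡ 0ℚ
  alternating-interior {zero}  zero    i≢k = contradiction refl i≢k
  alternating-interior {suc k} zero    i≢k = trans (alternating-suc {suc k} zero) (cong (λ q → 1ℚ ℚ.- q) (alternating-zero k))
  alternating-interior {suc k} (suc i) i≢k = trans (alternating-suc (suc i))
    (cong (λ q → 0ℚ ℚ.- q) (alternating-interior i λ i≡k → i≢k (cong suc i≡k)))

  -- The last vertex lies on one edge only; lengthening the path negates the value, which starts at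
  -- 1.
  alternating-last : ∀ k → dot alternating (incidence {suc k} (fromℕ (suc k))) ≢ 0ℚ
  alternating-last zero    ()
  alternating-last (suc k) e = alternating-last k (begin
    d             ≡⟨ solve 1 (λ a → a := :- (con 0ℚ :- a)) refl d ⟩
    ℚ.- (0ℚ ℚ.- d) ≡⟨ cong ℚ.-_ (trans (sym (alternating-suc (fromℕ (suc k)))) e) ⟩
    0ℚ            ∎)
    where
    open ≡-Reasoning
    open +-*-Solver
    d : ℚ
    d = dot alternating (incidence {suc k} (fromℕ (suc k)))

-- Deleting vertex 0 of the cycle leaves a path, which is represented by
-- the incidence vectors of its k + 1 edges; the alternating vector is
-- orthogonal to those of its inner vertices only.
module Cycle (k : ℕ) where

  open Path

  private
    C : Graph (3 + k)
    C = cycle (3 + k)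

  path-edge : ∀ {i j : Fin (2 + k)} → toℕ j ≡ suc (toℕ i) → ∃[ a ] (i ≡ inject₁ a × j ≡ suc a)
  path-edge {i} {suc a} e = a , Fin.toℕ-injective (trans (sym (ℕ.suc-injective e)) (sym (Fin.toℕ-inject₁ a))) , refl

  path-adjacent : ∀ {i j} → Adj C (suc i) (suc j) → ∃[ a ] (Incident i a × Incident j a)
  path-adjacent (_ , inj₁ (inj₁ e)) = let a , p , q = path-edge (ℕ.suc-injective e) in a , inj₁ p , inj₂ q
  path-adjacent (_ , inj₂ (inj₁ e)) = let a , p , q = path-edge (ℕ.suc-injective e) in a , inj₂ q , inj₁ p

  path-common : ∀ {i j} a → i ≢ j → Incident i a → Incident j a → Adj C (suc i) (suc j)
  path-common a i≢j (inj₁ refl) (inj₁ refl) = contradiction refl i≢j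
  path-common a i≢j (inj₁ refl) (inj₂ refl) =
    (λ e → i≢j (Fin.suc-injective e)) , inj₁ (inj₁ (cong (2 +_) (sym (Fin.toℕ-inject₁ a))))
  path-common a i≢j (inj₂ refl) (inj₁ refl) =
    (λ e → i≢j (Fin.suc-injective e)) , inj₂ (inj₁ (cong (2 +_) (sym (Fin.toℕ-inject₁ a))))
  path-common a i≢j (inj₂ refl) (inj₂ refl) = contradiction refl i≢j

  zero-adjacent : ∀ {i} → Adj C zero (suc i) → i ≡ zero ⊎ i ≡ fromℕ (suc k)
  zero-adjacent (_ , inj₁ (inj₁ e)) = inj₁ (Fin.toℕ-injective (ℕ.suc-injective e))
  zero-adjacent (_ , inj₂ (inj₂ (e , _))) =
    inj₂ (Fin.toℕ-injective (trans (ℕ.suc-injective (ℕ.suc-injective e)) (sym (Fin.toℕ-fromℕ (suc k)))))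

  zero-first : Adj C zero (suc zero)
  zero-first = (λ ()) , inj₁ (inj₁ refl)

  zero-last : Adj C zero (suc (fromℕ (suc k)))
  zero-last = (λ ()) , inj₂ (inj₂ (cong (2 +_) (Fin.toℕ-fromℕ (suc k)) , refl))

  vector : Fin (3 + k) → Vector ℚ (suc k)
  vector zero    = alternating
  vector (suc i) = incidence i

  adjacent-zero : ∀ {i} → Adj C zero (suc i) → dot alternating (incidence {suc k} i) ≢ 0ℚ
  adjacent-zero 0i with zero-adjacent 0i
  ... | inj₁ refl = subst (_≢ 0ℚ) (sym (alternating-zero k)) ℚ.1≢0
  ... | inj₂ refl = alternating-last k

  nonadjacent-zero : ∀ {i} → ¬ Adj C zero (suc i) → dot alternating (incidence {suc k} i) ≡ 0ℚ
  nonadjacent-zero {zero}  ¬0i = contradiction zero-first ¬0i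
  nonadjacent-zero {suc i} ¬0i = alternating-interior i λ { refl → ¬0i zero-last }

  adjacent : ∀ i j → Adj C i j → dot (vector i) (vector j) ≢ 0ℚ
  adjacent zero    zero    (0≢0 , _) = contradiction refl 0≢0
  adjacent zero    (suc j) ij = adjacent-zero ij
  adjacent (suc i) zero    ij = subst (_≢ 0ℚ) (dot-comm alternating (incidence i)) (adjacent-zero (adj-sym C {suc i} {zero} ij))
  adjacent (suc i) (suc j) ij = let a , ia , ja = path-adjacent ij in incident-dot ia ja

  nonadjacent : ∀ i j → i ≢ j → ¬ Adj C i j → dot (vector i) (vector j) ≡ 0ℚ
  nonadjacent zero    zero    0≢0 _   = contradiction refl 0≢0
  nonadjacent zero    (suc j) _   ¬ij = nonadjacent-zero ¬ij
  nonadjacent (suc i) zero    _   ¬ij = trans (dot-comm (incidence i) alternating)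
    (nonadjacent-zero λ 0i → ¬ij (adj-sym C {zero} {suc i} 0i))
  nonadjacent (suc i) (suc j) i≢j ¬ij = nonincident-dot {i = i} {j} λ a ia ja →
    ¬ij (path-common a (λ i≡j → i≢j (cong suc i≡j)) ia ja)

  2ℚ : ℚ
  2ℚ = 1ℚ ℚ.+ 1ℚ

  -- The all-ones vector would be orthogonal to `alternating` whenever the number of edges is even.
  -- The weight 2 on the first edge makes the product 2 or 1 instead, and positive entries keep it
  -- nonorthogonal to the incidence vectors.
  apex : Vector ℚ (suc k)
  apex zero    = 2ℚ
  apex (suc a) = 1ℚ

  apex>0 : ∀ a → 0ℚ ℚ.< apex a
  apex>0 zero    = ℚ.positive⁻¹ 2ℚ
  apex>0 (suc a) = ℚ.positive⁻¹ 1ℚ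

  dot-alternating-apex : dot alternating apex ≡ 2ℚ ℚ.- sumℚ (alternating {k})
  dot-alternating-apex = cong (2ℚ ℚ.+_) (trans
    (ℚ-Sum.sum-cong-≗ {k} λ a → ℚ.*-identityʳ (ℚ.- alternating a)) (sum-neg (alternating {k})))

  meets : ∀ i → dot (vector i) apex ≢ 0ℚ
  meets zero e with sum-alternating k
  ... | inj₁ s with () ← trans (sym e) (trans dot-alternating-apex (cong (λ q → 2ℚ ℚ.- q) s))
  ... | inj₂ s with () ← trans (sym e) (trans dot-alternating-apex (cong (λ q → 2ℚ ℚ.- q) s))
  meets (suc i) = let a , ia = edge i in
    dot≢0 (incidence i) apex (incidence≥0 i) (λ a → ℚ.<⇒≤ (apex>0 a)) a (incidence>0 ia) (apex>0 a)
    where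
    edge : ∀ (i : Fin (2 + k)) → ∃[ a ] Incident i a
    edge zero    = zero , inj₁ refl
    edge (suc a) = a , inj₂ refl

  coneRepresentation : ConeRepresentation C (suc k)
  coneRepresentation = record
    { representation = record
      { vector      = vector
      ; adjacent    = λ {i} {j} → adjacent i j
      ; nonadjacent = λ {i} {j} → nonadjacent i j
      }
    ; apex  = apex
    ; meets = meets
    }

  -- Vertices 0 and 1 are initial, and each further vertex is forced by its predecessor. W is the
  -- whole vertex set, so the boundary condition is empty and this is ordinary zero forcing: the
  -- other neighbour of the predecessor is forced earlier.
  forcingComplement : ForcingComplement C (suc k)
  forcingComplement = record
    { vertex    = λ a → suc (suc a)
    ; injective = λ e → Fin.suc-injective (Fin.suc-injective e)
    ; forced    = λ v → forced (toℕ v) v ℕ.≤-refl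
    }
    where
    F : Fin (3 + k) → Set₁
    F = Forced (Adj C) (λ w → ∀ a → suc (suc a) ≢ w)

    -- Recursion runs on the bound t, since the predecessor `suc (inject₁ v)` is not a subterm of
    -- `suc (suc v)`.
    forced : ∀ t v → toℕ v ≤ t → F v
    forced t       zero          _ = initial λ _ ()
    forced t       (suc zero)    _ = initial λ _ ()
    forced (suc t) (suc (suc v)) (s≤s v≤t) =
      force {u = suc (inject₁ v)} (λ _ → ⊤) tt
        ((λ e → ℕ.m≢1+n+m (toℕ v) {0} (trans (sym (Fin.toℕ-inject₁ v)) (cong toℕ (Fin.suc-injective e))))
          , inj₁ (inj₁ (cong (2 +_) (sym (Fin.toℕ-inject₁ v)))))
        (forced t (suc (inject₁ v)) (subst (_≤ t) (cong suc (sym (Fin.toℕ-inject₁ v))) v≤t))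
        (λ _ ¬⊤ _ → contradiction tt ¬⊤)
        (λ {j} _ → neighbours j)
      where
      neighbours : ∀ j → Adj C (suc (inject₁ v)) j → j ≢ suc (suc v) → F j
      neighbours zero          _                        _   = initial λ _ ()
      neighbours (suc zero)    _                        _   = initial λ _ ()
      neighbours (suc (suc j)) (_ , inj₁ (inj₁ e))      j≢v =
        contradiction (Fin.toℕ-injective (trans e (cong (2 +_) (Fin.toℕ-inject₁ v)))) j≢v
      neighbours (suc (suc j)) (_ , inj₂ (inj₁ e))      j≢v =
        forced t (suc (suc j)) (ℕ.≤-trans (ℕ.≤-trans (ℕ.n≤1+n _) (ℕ.≤-reflexive (trans (sym e) (cong suc (Fin.toℕ-inject₁ v))))) v≤t)

-- Combining certificates and the nine formulas

Certificate : ∀ {n} → Graph n → ℕ → Set₁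
Certificate G r = ConeRepresentation G r × ForcingComplement G r

corona-mr₊ : ∀ {n m r s} {G : Graph n} {H : Graph m} → Certificate G r → Certificate H s →
  IsMr₊ (G ∘ᶜ H) (r + n * s)
corona-mr₊ {G = G} {H} (R₁ , F₁) (R₂ , F₂) = isMr₊
  (Corona.gramRepresentation G H (ConeRepresentation.representation R₁) R₂)
  (Corona.forcingComplement G H F₁ F₂)

tree-certificate : ∀ {m} → 2 ≤ m → (T : Graph m) → IsTree T → Certificate T (m ∸ 1)
tree-certificate (s≤s 1≤k) T T-tree = Tree.coneRepresentation T T-tree 1≤k , Tree.forcingComplement T T-tree

complete-certificate : ∀ {n} → 2 ≤ n → Certificate (complete n) 1
complete-certificate (s≤s (s≤s {n = n} _)) = Complete.coneRepresentation n , Complete.forcingComplement n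

cycle-certificate : ∀ {n} → 3 ≤ n → Certificate (cycle n) (n ∸ 2)
cycle-certificate (s≤s (s≤s (s≤s {n = k} _))) = Cycle.coneRepresentation k , Cycle.forcingComplement k

tree∘tree : ∀ {m m'} → 2 ≤ m → 2 ≤ m' → (m ∸ 1) + m * (m' ∸ 1) ≡ m * m' ∸ 1
tree∘tree {suc k} {suc k'} _ _ = identity k k'
  where
  identity : ∀ k k' → k + (k' + k * k') ≡ k' + k * suc k'
  identity = solve-∀

tree∘complete : ∀ {m} → 2 ≤ m → (m ∸ 1) + m * 1 ≡ 2 * m ∸ 1
tree∘complete {suc k} _ = cong (k +_) (trans (ℕ.*-identityʳ (suc k)) (sym (ℕ.+-identityʳ (suc k))))

complete∘tree : ∀ n {m} → 2 ≤ m → 1 + n * (m ∸ 1) ≡ n * m ∸ n + 1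
complete∘tree n {suc k} _ = begin
  1 + n * k              ≡⟨ ℕ.+-comm 1 (n * k) ⟩
  n * k + 1              ≡⟨ cong (_+ 1) (ℕ.m+n∸m≡n n (n * k)) ⟨
  n + n * k ∸ n + 1      ≡⟨ cong (λ x → x ∸ n + 1) (ℕ.*-suc n k) ⟨
  n * suc k ∸ n + 1      ∎
  where open ≡-Reasoning

complete∘complete : ∀ n → 1 + n * 1 ≡ n + 1
complete∘complete n = trans (ℕ.+-comm 1 (n * 1)) (cong (_+ 1) (ℕ.*-identityʳ n))

-- As n is at least 2, subtracting 2 from n and from n + n(m - 1) = nm commutes with the addition;
-- the truncated differences are exact.
cycle∘tree : ∀ {n m} → 3 ≤ n → 2 ≤ m → (n ∸ 2) + n * (m ∸ 1) ≡ n * m ∸ 2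
cycle∘tree {n} {suc k} (s≤s (s≤s _)) _ = cong (_∸ 2) (sym (ℕ.*-suc n k))

tree∘cycle : ∀ {m n} → 2 ≤ m → 3 ≤ n → (m ∸ 1) + m * (n ∸ 2) ≡ m * (n ∸ 1) ∸ 1
tree∘cycle {suc k} {suc (suc j)} _ (s≤s (s≤s _)) = identity k j
  where
  identity : ∀ k j → k + (j + k * j) ≡ j + k * suc j
  identity = solve-∀

cycle∘complete : ∀ {n} → 3 ≤ n → (n ∸ 2) + n * 1 ≡ 2 * n ∸ 2
cycle∘complete {suc (suc k)} (s≤s (s≤s _)) = cong (k +_) (trans (ℕ.*-identityʳ (2 + k)) (sym (ℕ.+-identityʳ (2 + k))))

complete∘cycle : ∀ m n → 1 + m * (n ∸ 2) ≡ m * (n ∸ 2) + 1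
complete∘cycle m n = ℕ.+-comm 1 (m * (n ∸ 2))

cycle∘cycle : ∀ {n m} → 3 ≤ n → 3 ≤ m → (n ∸ 2) + n * (m ∸ 2) ≡ n * (m ∸ 1) ∸ 2
cycle∘cycle {n} {suc (suc j)} (s≤s (s≤s _)) (s≤s (s≤s _)) = cong (_∸ 2) (sym (ℕ.*-suc n j))

corollary3p13 : (∀ m m' → 2 ≤ m → 2 ≤ m' → (T : Graph m) (T' : Graph m') → IsTree T → IsTree T' →
    IsMr₊ (T ∘ᶜ T') (m * m' ∸ 1))
    × (∀ m n → 2 ≤ m → 2 ≤ n → (T : Graph m) → IsTree T →
    IsMr₊ (T ∘ᶜ complete n) (2 * m ∸ 1))
    × (∀ n m → 2 ≤ n → 2 ≤ m → (T : Graph m) → IsTree T →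
    IsMr₊ (complete n ∘ᶜ T) (n * m ∸ n + 1))
    × (∀ n m → 2 ≤ n → 2 ≤ m →
    IsMr₊ (complete n ∘ᶜ complete m) (n + 1))
    × (∀ n m → 3 ≤ n → 2 ≤ m → (T : Graph m) → IsTree T →
    IsMr₊ (cycle n ∘ᶜ T) (n * m ∸ 2))
    × (∀ m n → 2 ≤ m → 3 ≤ n → (T : Graph m) → IsTree T →
    IsMr₊ (T ∘ᶜ cycle n) (m * (n ∸ 1) ∸ 1))
    × (∀ n m → 3 ≤ n → 2 ≤ m →
    IsMr₊ (cycle n ∘ᶜ complete m) (2 * n ∸ 2))
    × (∀ m n → 2 ≤ m → 3 ≤ n →
    IsMr₊ (complete m ∘ᶜ cycle n) (m * (n ∸ 2) + 1))
    × (∀ n m → 3 ≤ n → 3 ≤ m →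
    IsMr₊ (cycle n ∘ᶜ cycle m) (n * (m ∸ 1) ∸ 2))
corollary3p13 =
    (λ m m' 2≤m 2≤m' T T' t t' → subst (IsMr₊ (T ∘ᶜ T')) (tree∘tree 2≤m 2≤m')
      (corona-mr₊ (tree-certificate 2≤m T t) (tree-certificate 2≤m' T' t')))
  , (λ m n 2≤m 2≤n T t → subst (IsMr₊ (T ∘ᶜ complete n)) (tree∘complete 2≤m)
      (corona-mr₊ (tree-certificate 2≤m T t) (complete-certificate 2≤n)))
  , (λ n m 2≤n 2≤m T t → subst (IsMr₊ (complete n ∘ᶜ T)) (complete∘tree n 2≤m)
      (corona-mr₊ (complete-certificate 2≤n) (tree-certificate 2≤m T t)))
  , (λ n m 2≤n 2≤m → subst (IsMr₊ (complete n ∘ᶜ complete m)) (complete∘complete n)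
      (corona-mr₊ (complete-certificate 2≤n) (complete-certificate 2≤m)))
  , (λ n m 3≤n 2≤m T t → subst (IsMr₊ (cycle n ∘ᶜ T)) (cycle∘tree 3≤n 2≤m)
      (corona-mr₊ (cycle-certificate 3≤n) (tree-certificate 2≤m T t)))
  , (λ m n 2≤m 3≤n T t → subst (IsMr₊ (T ∘ᶜ cycle n)) (tree∘cycle 2≤m 3≤n)
      (corona-mr₊ (tree-certificate 2≤m T t) (cycle-certificate 3≤n)))
  , (λ n m 3≤n 2≤m → subst (IsMr₊ (cycle n ∘ᶜ complete m)) (cycle∘complete 3≤n)
      (corona-mr₊ (cycle-certificate 3≤n) (complete-certificate 2≤m)))
  , (λ m n 2≤m 3≤n → subst (IsMr₊ (complete m ∘ᶜ cycle n)) (complete∘cycle m n)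
      (corona-mr₊ (complete-certificate 2≤m) (cycle-certificate 3≤n)))
  , (λ n m 3≤n 3≤m → subst (IsMr₊ (cycle n ∘ᶜ cycle m)) (cycle∘cycle 3≤n 3≤m)
      (corona-mr₊ (cycle-certificate 3≤n) (cycle-certificate 3≤m)))
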